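{- There is a fixed polynomial $q$ such that for every $\varepsilon>0$, every graph $G=(V,E)$ and every equipartition $\mathcal P_0$ of $V$, there is a weak $\varepsilon$-regular equipartition of $V$ refining $\mathcal P_0$ of order at most $|\mathcal P_0|\cdot 2^{q(1/\varepsilon)}$.
   Context: For vertex sets $A,B$, $e(A,B)$ counts ordered pairs $(u,v)\in A\times B$ with $uv\in E$, and $d(A,B)=e(A,B)/(|A||B|)$. An equipartition is a partition whose part sizes differ by at most $1$; its order is its number of parts. A partition $\{V_1,\dots,V_k\}$ of $V$ is weak $\varepsilon$-regular if for all disjoint $S,T\subseteq V$ with $|S|,|T|\ge\varepsilon|V|$, writing $S_i=S\cap V_i$, $T_j=T\cap V_j$, $$\sum_{i,j=1}^k \frac{|S_i||T_j|}{|S||T|}\,\big|d(S_i,T_j)-d(V_i,V_j)\big|\le\varepsilon$$ (terms with $S_i$ or $T_j$ empty are $0$). -}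

module Defs where

open import Data.Bool using (Bool; true; false; _∧_; if_then_else_)
open import Data.Nat as ℕ using (ℕ; zero; suc)
open import Data.Integer using (+_)
open import Data.Fin using (Fin; zero; suc)
open import Data.Fin.Subset using (Subset; _∈_; _∉_; ∣_∣)
open import Data.Vec using (Vec; tabulate; lookup)
open import Data.List using (List; []; _∷_)
open import Data.Product using (Σ; _×_; _,_)
open import Data.Rational.Unnormalised
  using (ℚᵘ; mkℚᵘ; 0ℚᵘ; 1ℚᵘ; _+_; _*_; _-_; _≤_; _≃_; _>_; 1/_; >-nonZero)
  renaming (∣_∣ to abs)
open import Relation.Binary.PropositionalEquality using (_≡_; _≢_)
open import Relation.Nullary.Decidable using (⌊_⌋)
open import Data.Fin.Properties using (_≟_)

record Graph (n : ℕ) : Set where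
  field
    adj   : Fin n → Fin n → Bool
    sym   : ∀ u v → adj u v ≡ adj v u
    irrefl : ∀ u → adj u u ≡ false

open Graph public

sumℕ : ∀ k → (Fin k → ℕ) → ℕ
sumℕ zero f = 0
sumℕ (suc k) f = f zero ℕ.+ sumℕ k (λ i → f (suc i))

sumℚ : ∀ k → (Fin k → ℚᵘ) → ℚᵘ
sumℚ zero f = 0ℚᵘ
sumℚ (suc k) f = f zero + sumℚ k (λ i → f (suc i))

[_] : Bool → ℕ
[ true ] = 1
[ false ] = 0

-- natural-number fraction a / b as a rational; convention a/0 := 0
-- (only used where the denominator is nonzero, or the numerator is 0 as well)
frac : ℕ → ℕ → ℚᵘ
frac a zero = 0ℚᵘ
frac a (suc b) = mkℚᵘ (+ a) b

ℕ→ℚ : ℕ → ℚᵘ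
ℕ→ℚ a = mkℚᵘ (+ a) 0

e : ∀ {n} → Graph n → Subset n → Subset n → ℕ
e {n} G A B = sumℕ n (λ u → sumℕ n (λ v →
  [ lookup A u ∧ (lookup B v ∧ adj G u v) ]))

dens : ∀ {n} → Graph n → Subset n → Subset n → ℚᵘ
dens G A B = frac (e G A B) (∣ A ∣ ℕ.* ∣ B ∣)

record Partition (n k : ℕ) : Set where
  field
    part : Fin n → Fin k
    nonempty : ∀ i → Σ (Fin n) (λ v → part v ≡ i)

open Partition public

cell : ∀ {n k} → Partition n k → Fin k → Subset n
cell P i = tabulate (λ v → ⌊ part P v ≟ i ⌋)

IsEquipartition : ∀ {n k} → Partition n k → Set
IsEquipartition {k = k} P = ∀ i j → ∣ cell P i ∣ ℕ.≤ suc ∣ cell P j ∣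

Refines : ∀ {n k k₀} → Partition n k → Partition n k₀ → Set
Refines {k = k} {k₀} P P₀ =
  Σ (Fin k → Fin k₀) (λ f → ∀ v → part P₀ v ≡ f (part P v))

Disjoint : ∀ {n} → Subset n → Subset n → Set
Disjoint S T = ∀ v → v ∈ S → v ∉ T

intersect : ∀ {n} → Subset n → Subset n → Subset n
intersect S T = tabulate (λ v → lookup S v ∧ lookup T v)

irregularity : ∀ {n k} → Graph n → Partition n k → Subset n → Subset n → ℚᵘ
irregularity {n} {k} G P S T =
  sumℚ k (λ i → sumℚ k (λ j →
    let Si = intersect S (cell P i)
        Tj = intersect T (cell P j)
    in frac (∣ Si ∣ ℕ.* ∣ Tj ∣) (∣ S ∣ ℕ.* ∣ T ∣)
       * abs (dens G Si Tj - dens G (cell P i) (cell P j))))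

WeakRegular : ∀ {n k} → Graph n → ℚᵘ → Partition n k → Set
WeakRegular {n} G ε P = ∀ (S T : Subset n) → Disjoint S T →
  ε * ℕ→ℚ n ≤ ℕ→ℚ ∣ S ∣ → ε * ℕ→ℚ n ≤ ℕ→ℚ ∣ T ∣ →
  irregularity G P S T ≤ ε

evalPoly : List ℕ → ℚᵘ → ℚᵘ
evalPoly [] x = 0ℚᵘ
evalPoly (c ∷ cs) x = ℕ→ℚ c + x * evalPoly cs x

inv : (ε : ℚᵘ) → ε > 0ℚᵘ → ℚᵘ
inv ε ε>0 = (1/ ε) {{>-nonZero ε>0}}

-- k ≤ k₀ · 2^r for a nonnegative rational r, expressed exactly:
-- if r = a/(b+1) then k^(b+1) ≤ k₀^(b+1) · 2^a.
BoundedBy : ℕ → ℕ → ℚᵘ → Set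
BoundedBy k k₀ r = ∀ (a b : ℕ) → r ≃ mkℚᵘ (+ a) b →
  k ℕ.^ suc b ℕ.≤ k₀ ℕ.^ suc b ℕ.* 2 ℕ.^ a

{-# OPTIONS --safe #-}

-- Energy increment.  Let d be the density step function of a partition P on V × V and let its energy
-- be the sum of d², which is at most n².  With 1/N ≤ ε and K = 2N³, suppose that sets S, T violate
-- weak regularity.  Cut every cell into 4K + 1 blocks so that S and T agree with unions of blocks up to
-- one block per cell each.  The deviation of the edge indicator from the new density d′ is orthogonal to
-- every function of the new cells, so the irregularity of (S, T) is controlled by the sum of |d′ − d|
-- and a small error; as the sum of (d′ − d)² is the gain of energy, the energy grows by at least n²/K².
-- Cutting cells of sizes m and m + 1 into equally many blocks keeps the partition equitable, and if
-- cells become too small to be cut, the partition into singletons is regular.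
module Submission where

open import Defs
open import Algebra.Bundles using (CommutativeSemiring; CommutativeRing)
import Algebra.Properties.Semiring.Sum as SemiringSum
open import Data.Bool using (Bool; true; false; _∧_; not; if_then_else_)
open import Data.Fin as Fin using (Fin; zero; suc; toℕ; combine; remQuot)
import Data.Fin.Properties as Fin
open import Data.Fin.Properties using (_≟_)
open import Data.Fin.Subset using (Subset; ∣_∣)
open import Data.Fin.Subset.Properties using (anySubset?; _∈?_)
open import Data.Integer as ℤ using (+_; +[1+_]; -[1+_])
import Data.Integer.Properties as ℤ
open import Data.List using (List; []; _∷_)
open import Data.Nat as ℕ using (ℕ; zero; suc)
open import Data.Nat.Divisibility using (n∣n)
import Data.Nat.DivMod as ℕ
import Data.Nat.Properties as ℕ
open import Data.Nat.Tactic.RingSolver using (solve-∀)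
open import Data.Product using (Σ; _×_; _,_; proj₁; proj₂)
open import Data.Rational.Unnormalised as ℚ using (ℚᵘ; mkℚᵘ; 0ℚᵘ; 1ℚᵘ; _>_)
import Data.Rational.Unnormalised.Properties as ℚ
open import Data.Rational.Unnormalised.Solver using (module +-*-Solver)
open import Data.Sum using (_⊎_; inj₁; inj₂; [_,_]′)
open import Data.Vec using ([]; _∷_; lookup)
open import Data.Vec.Properties using (lookup∘tabulate; lookup⇒[]=)
open import Function using (_∘_; id)
open import Level using (0ℓ)
open import Relation.Binary.PropositionalEquality as ≡ using (_≡_; refl; cong; cong₂)
open import Relation.Nullary using (¬_; Dec; contradiction; ¬?)
open import Relation.Nullary.Decidable using (⌊_⌋; yes; no; _×-dec_; _→-dec_)

-- Finite sums

-- A tower-type bound arises when every irregular pair of cells supplies its own witnesses, since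
-- the order then grows exponentially in each round. Here one pair (S, T) serves the whole graph, so
-- a round multiplies the order by a fixed factor of size O(N³); with O(N⁶) rounds the exponent
-- stays polynomial and independent of n. The obstacle is the demand for exact equipartitions that
-- refine: the intersections of the cells with S and T have arbitrary sizes, and no vertex may leave
-- its cell of P₀ to even them out. Hence S and T are only approximated by unions of blocks. This is
-- affordable because the deviation from the old density is at most 1 in absolute value, so the
-- approximation costs no more than the number of vertex pairs that meet a boundary block. Densities
-- are compared after clearing denominators, as sums over pairs of vertices: the weights in the
-- definition of irregularity are just what cancels the denominators.

⌊suc≟suc⌋ : ∀ {n} (i j : Fin n) → ⌊ suc i ≟ suc j ⌋ ≡ ⌊ i ≟ j ⌋
⌊suc≟suc⌋ i j with i ≟ j
... | yes _ = refl
... | no  _ = refl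

-- The same identities serve counts in ℕ and weights in ℚᵘ. `ι` encodes a Boolean as 0 or 1, so that
-- restricting a sum to a fibre is a multiplication.
module Sums (R : CommutativeSemiring 0ℓ 0ℓ)
  (Σ : ∀ k → (Fin k → CommutativeSemiring.Carrier R) → CommutativeSemiring.Carrier R)
  (Σ≡sum : ∀ k f → Σ k f ≡ SemiringSum.sum (CommutativeSemiring.semiring R) f)
  (ι : Bool → CommutativeSemiring.Carrier R)
  (ι-true : CommutativeSemiring._≈_ R (ι true) (CommutativeSemiring.1# R))
  (ι-false : CommutativeSemiring._≈_ R (ι false) (CommutativeSemiring.0# R)) where

  open CommutativeSemiring R hiding (zero; refl)
  module ∑ = SemiringSum semiring
  open import Relation.Binary.Reasoning.Setoid setoid

  Σ-cong : ∀ n {f g : Fin n → Carrier} → (∀ i → f i ≈ g i) → Σ n f ≈ Σ n g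
  Σ-cong n {f} {g} f≈g rewrite Σ≡sum n f | Σ≡sum n g = ∑.sum-cong-≋ f≈g

  Σ-+ : ∀ n (f g : Fin n → Carrier) → Σ n (λ i → f i + g i) ≈ Σ n f + Σ n g
  Σ-+ n f g rewrite Σ≡sum n (λ i → f i + g i) | Σ≡sum n f | Σ≡sum n g = ∑.∑-distrib-+ f g

  Σ-*ˡ : ∀ n c (f : Fin n → Carrier) → c * Σ n f ≈ Σ n (λ i → c * f i)
  Σ-*ˡ n c f rewrite Σ≡sum n (λ i → c * f i) | Σ≡sum n f = ∑.*-distribˡ-sum c f

  Σ-*ʳ : ∀ n c (f : Fin n → Carrier) → Σ n f * c ≈ Σ n (λ i → f i * c)
  Σ-*ʳ n c f rewrite Σ≡sum n (λ i → f i * c) | Σ≡sum n f = ∑.*-distribʳ-sum c f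

  Σ-*-Σ : ∀ m n (f : Fin m → Carrier) (g : Fin n → Carrier) →
    Σ m f * Σ n g ≈ Σ m (λ i → Σ n (λ j → f i * g j))
  Σ-*-Σ m n f g = trans (Σ-*ʳ m _ f) (Σ-cong m λ i → Σ-*ˡ n (f i) g)

  Σ-0 : ∀ n → Σ n (λ _ → 0#) ≈ 0#
  Σ-0 n rewrite Σ≡sum n (λ _ → 0#) = ∑.sum-replicate-zero n

  Σ-comm : ∀ m n (F : Fin m → Fin n → Carrier) →
    Σ m (λ i → Σ n (F i)) ≈ Σ n (λ j → Σ m (λ i → F i j))
  Σ-comm m n F = begin
    Σ m (λ i → Σ n (F i))                  ≈⟨ Σ-cong m (λ i → reflexive (Σ≡sum n (F i))) ⟩
    Σ m (λ i → ∑.sum (F i))                ≡⟨ Σ≡sum m _ ⟩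
    ∑.sum (λ i → ∑.sum (F i))              ≈⟨ ∑.∑-comm F ⟩
    ∑.sum (λ j → ∑.sum (λ i → F i j))      ≡⟨ Σ≡sum n _ ⟨
    Σ n (λ j → ∑.sum (λ i → F i j))        ≈⟨ Σ-cong n (λ j → reflexive (Σ≡sum m (λ i → F i j))) ⟨
    Σ n (λ j → Σ m (λ i → F i j))          ∎

  ∑-pick : ∀ {k} (j : Fin k) (g : Fin k → Carrier) →
    ∑.sum (λ i → ι ⌊ j ≟ i ⌋ * g i) ≈ g j
  ∑-pick {suc k} zero g = begin
    ι true * g zero + ∑.sum (λ i → ι false * g (suc i))
      ≈⟨ +-cong (trans (*-congʳ ι-true) (*-identityˡ _))
                (trans (∑.sum-cong-≋ {k} λ i → trans (*-congʳ ι-false) (zeroˡ (g (suc i))))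
                       (∑.sum-replicate-zero k)) ⟩
    g zero + 0#  ≈⟨ +-identityʳ _ ⟩
    g zero       ∎
  ∑-pick {suc k} (suc j) g = begin
    ι false * g zero + ∑.sum (λ i → ι ⌊ suc j ≟ suc i ⌋ * g (suc i))
      ≈⟨ +-cong (trans (*-congʳ ι-false) (zeroˡ _))
                (trans (∑.sum-cong-≋ {k} λ i → *-congʳ (reflexive (cong ι (⌊suc≟suc⌋ j i))))
                       (∑-pick j (g ∘ suc))) ⟩
    0# + g (suc j)  ≈⟨ +-identityˡ _ ⟩
    g (suc j)       ∎

  Σ-pick : ∀ k (j : Fin k) (g : Fin k → Carrier) → Σ k (λ i → ι ⌊ j ≟ i ⌋ * g i) ≈ g j
  Σ-pick k j g rewrite Σ≡sum k (λ i → ι ⌊ j ≟ i ⌋ * g i) = ∑-pick j g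

  -- The factor `1 = Σ_i ι ⌊ p u ≟ i ⌋` is inserted under the sum, and the two sums are exchanged.
  Σ-fibres : ∀ {n k} (p : Fin n → Fin k) (F : Fin n → Carrier) →
    Σ n F ≈ Σ k (λ i → Σ n (λ u → ι ⌊ p u ≟ i ⌋ * F u))
  Σ-fibres {n} {k} p F = begin
    Σ n F
      ≈⟨ Σ-cong n (λ u → Σ-pick k (p u) (λ _ → F u)) ⟨
    Σ n (λ u → Σ k (λ i → ι ⌊ p u ≟ i ⌋ * F u))
      ≈⟨ Σ-comm n k _ ⟩
    Σ k (λ i → Σ n (λ u → ι ⌊ p u ≟ i ⌋ * F u)) ∎

open import Data.Rational.Unnormalised using (_+_; _*_; _-_; -_; _≤_; _<_; _≃_) renaming (∣_∣ to abs)
open +-*-Solver using (solve; _:+_; _:*_; _:-_; :-_; _:=_; con)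

sumℕ≡sum : ∀ n f → sumℕ n f ≡ SemiringSum.sum ℕ.+-*-semiring f
sumℕ≡sum zero    f = refl
sumℕ≡sum (suc n) f = cong (f zero ℕ.+_) (sumℕ≡sum n (f ∘ suc))

module ℕΣ = Sums ℕ.+-*-commutativeSemiring sumℕ sumℕ≡sum [_] refl refl

sumℚ≡sum : ∀ n f → sumℚ n f ≡ SemiringSum.sum (CommutativeRing.semiring ℚ.+-*-commutativeRing) f
sumℚ≡sum zero    f = refl
sumℚ≡sum (suc n) f = cong (f zero ℚ.+_) (sumℚ≡sum n (f ∘ suc))

𝟙 : Bool → ℚᵘ
𝟙 b = ℕ→ℚ [ b ]

module ℚΣ = Sums (CommutativeRing.commutativeSemiring ℚ.+-*-commutativeRing) sumℚ sumℚ≡sum 𝟙 ℚ.≃-refl ℚ.≃-refl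

sumℕ-mono : ∀ n {f g : Fin n → ℕ} → (∀ i → f i ℕ.≤ g i) → sumℕ n f ℕ.≤ sumℕ n g
sumℕ-mono zero    f≤g = ℕ.z≤n
sumℕ-mono (suc n) f≤g = ℕ.+-mono-≤ (f≤g zero) (sumℕ-mono n (f≤g ∘ suc))

sumℕ-const : ∀ n c → sumℕ n (λ _ → c) ≡ n ℕ.* c
sumℕ-const zero    c = refl
sumℕ-const (suc n) c = cong (c ℕ.+_) (sumℕ-const n c)

∣S∣≡Σ : ∀ {n} (S : Subset n) → ∣ S ∣ ≡ sumℕ n (λ u → [ lookup S u ])
∣S∣≡Σ []          = refl
∣S∣≡Σ (true ∷ S)  = cong suc (∣S∣≡Σ S)
∣S∣≡Σ (false ∷ S) = ∣S∣≡Σ S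

sumℚ-mono : ∀ n {f g : Fin n → ℚᵘ} → (∀ i → f i ≤ g i) → sumℚ n f ≤ sumℚ n g
sumℚ-mono zero    f≤g = ℚ.≤-refl
sumℚ-mono (suc n) f≤g = ℚ.+-mono-≤ (f≤g zero) (sumℚ-mono n (f≤g ∘ suc))

abs-sumℚ : ∀ n (f : Fin n → ℚᵘ) → abs (sumℚ n f) ≤ sumℚ n (λ i → abs (f i))
abs-sumℚ zero    f = ℚ.≤-refl
abs-sumℚ (suc n) f = ℚ.≤-trans (ℚ.∣p+q∣≤∣p∣+∣q∣ (f zero) (sumℚ n (f ∘ suc)))
  (ℚ.+-monoʳ-≤ (abs (f zero)) (abs-sumℚ n (f ∘ suc)))

ℕ→ℚ-+ : ∀ a b → ℕ→ℚ (a ℕ.+ b) ≃ ℕ→ℚ a + ℕ→ℚ b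
ℕ→ℚ-+ a b = ℚ.*≡* (cong (ℤ._* + 1) (≡.sym (cong₂ ℤ._+_ (ℤ.*-identityʳ (+ a)) (ℤ.*-identityʳ (+ b)))))

ℕ→ℚ-* : ∀ a b → ℕ→ℚ (a ℕ.* b) ≃ ℕ→ℚ a * ℕ→ℚ b
ℕ→ℚ-* a b = ℚ.*≡* (cong (ℤ._* + 1) (ℤ.pos-* a b))

ℕ→ℚ-mono : ∀ {a b} → a ℕ.≤ b → ℕ→ℚ a ≤ ℕ→ℚ b
ℕ→ℚ-mono a≤b = ℚ.*≤* (ℤ.*-monoʳ-≤-nonNeg (+ 1) (ℤ.+≤+ a≤b))

ℕ→ℚ-cancel-≤ : ∀ {a b} → ℕ→ℚ a ≤ ℕ→ℚ b → a ℕ.≤ b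
ℕ→ℚ-cancel-≤ {a} {b} (ℚ.*≤* h) = ℤ.drop‿+≤+ (ℤ.*-cancelʳ-≤-pos (+ a) (+ b) (+ 1) h)

ℕ→ℚ-sum : ∀ n f → ℕ→ℚ (sumℕ n f) ≃ sumℚ n (λ i → ℕ→ℚ (f i))
ℕ→ℚ-sum zero    f = ℚ.≃-refl
ℕ→ℚ-sum (suc n) f = ℚ.≃-trans (ℕ→ℚ-+ (f zero) _)
  (ℚ.+-congʳ (ℕ→ℚ (f zero)) (ℕ→ℚ-sum n (f ∘ suc)))

[]-∧ : ∀ a b → [ a ∧ b ] ≡ [ a ] ℕ.* [ b ]
[]-∧ true  b = ≡.sym (ℕ.+-identityʳ _)
[]-∧ false b = refl

[]≤1 : ∀ b → [ b ] ℕ.≤ 1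
[]≤1 true  = ℕ.≤-refl
[]≤1 false = ℕ.z≤n

Σ² : ∀ n → (Fin n → Fin n → ℚᵘ) → ℚᵘ
Σ² n F = sumℚ n (λ u → sumℚ n (λ v → F u v))

Σ²-cong : ∀ n {F H : Fin n → Fin n → ℚᵘ} → (∀ u v → F u v ≃ H u v) → Σ² n F ≃ Σ² n H
Σ²-cong n F≃H = ℚΣ.Σ-cong n λ u → ℚΣ.Σ-cong n (F≃H u)

Σ²-mono : ∀ n {F H : Fin n → Fin n → ℚᵘ} → (∀ u v → F u v ≤ H u v) → Σ² n F ≤ Σ² n H
Σ²-mono n F≤H = sumℚ-mono n λ u → sumℚ-mono n (F≤H u)

Σ²-+ : ∀ n (F H : Fin n → Fin n → ℚᵘ) →
  Σ² n (λ u v → F u v + H u v) ≃ Σ² n F + Σ² n H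
Σ²-+ n F H = ℚ.≃-trans (ℚΣ.Σ-cong n λ u → ℚΣ.Σ-+ n (F u) (H u)) (ℚΣ.Σ-+ n _ _)

Σ²-*ˡ : ∀ n c (F : Fin n → Fin n → ℚᵘ) → c * Σ² n F ≃ Σ² n (λ u v → c * F u v)
Σ²-*ˡ n c F = ℚ.≃-trans (ℚΣ.Σ-*ˡ n c _) (ℚΣ.Σ-cong n λ u → ℚΣ.Σ-*ˡ n c (F u))

Σ²-0 : ∀ n → Σ² n (λ _ _ → 0ℚᵘ) ≃ 0ℚᵘ
Σ²-0 n = ℚ.≃-trans (ℚΣ.Σ-cong n (λ u → ℚΣ.Σ-0 n)) (ℚΣ.Σ-0 n)

Σ²-abs : ∀ n (F : Fin n → Fin n → ℚᵘ) → abs (Σ² n F) ≤ Σ² n (λ u v → abs (F u v))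
Σ²-abs n F = ℚ.≤-trans (abs-sumℚ n _) (sumℚ-mono n λ u → abs-sumℚ n (F u))

ℕ→ℚ-Σ² : ∀ n (F : Fin n → Fin n → ℕ) →
  ℕ→ℚ (sumℕ n (λ u → sumℕ n (F u))) ≃ Σ² n (λ u v → ℕ→ℚ (F u v))
ℕ→ℚ-Σ² n F = ℚ.≃-trans (ℕ→ℚ-sum n _) (ℚΣ.Σ-cong n λ u → ℕ→ℚ-sum n (F u))

𝟙-∧ : ∀ a b → 𝟙 (a ∧ b) ≃ 𝟙 a * 𝟙 b
𝟙-∧ a b = ℚ.≃-trans (ℚ.≃-reflexive (cong ℕ→ℚ ([]-∧ a b))) (ℕ→ℚ-* [ a ] [ b ])

module _ {n k} (P : Partition n k) where

  ind : Fin k → Fin k → Fin n → Fin n → ℚᵘ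
  ind i j u v = 𝟙 ⌊ part P u ≟ i ⌋ * 𝟙 ⌊ part P v ≟ j ⌋

  Σ²-blocks : ∀ (F : Fin n → Fin n → ℚᵘ) →
    Σ² n F ≃ sumℚ k (λ i → sumℚ k (λ j → Σ² n (λ u v → ind i j u v * F u v)))
  Σ²-blocks F = begin-equality
    sumℚ n (λ u → sumℚ n (F u))
      ≃⟨ ℚΣ.Σ-fibres (part P) _ ⟩
    sumℚ k (λ i → sumℚ n (λ u → α i u * sumℚ n (F u)))
      ≃⟨ ℚΣ.Σ-cong k (λ i → ℚΣ.Σ-cong n λ u → ℚ.*-congˡ {α i u} (ℚΣ.Σ-fibres (part P) (F u))) ⟩
    sumℚ k (λ i → sumℚ n (λ u → α i u * sumℚ k (λ j → sumℚ n (λ v → α j v * F u v))))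
      ≃⟨ ℚΣ.Σ-cong k (λ i → ℚΣ.Σ-cong n λ u → ℚ.≃-trans (ℚΣ.Σ-*ˡ k (α i u) _)
           (ℚΣ.Σ-cong k λ j → ℚ.≃-trans (ℚΣ.Σ-*ˡ n (α i u) _)
           (ℚΣ.Σ-cong n λ v → ℚ.≃-sym (ℚ.*-assoc (α i u) (α j v) (F u v))))) ⟩
    sumℚ k (λ i → sumℚ n (λ u → sumℚ k (λ j → sumℚ n (λ v → ind i j u v * F u v))))
      ≃⟨ ℚΣ.Σ-cong k (λ i → ℚΣ.Σ-comm n k _) ⟩
    sumℚ k (λ i → sumℚ k (λ j → Σ² n (λ u v → ind i j u v * F u v))) ∎
    where
    open ℚ.≤-Reasoning
    α : Fin k → Fin n → ℚᵘ
    α i u = 𝟙 ⌊ part P u ≟ i ⌋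

-- Densities as sums over pairs of vertices

lookup-cell : ∀ {n k} (P : Partition n k) i u → lookup (cell P i) u ≡ ⌊ part P u ≟ i ⌋
lookup-cell P i u = lookup∘tabulate _ u

lookup-intersect : ∀ {n} (S T : Subset n) u → lookup (intersect S T) u ≡ lookup S u ∧ lookup T u
lookup-intersect S T u = lookup∘tabulate _ u

frac-* : ∀ a b → (b ≡ 0 → a ≡ 0) → frac a b * ℕ→ℚ b ≃ ℕ→ℚ a
frac-* a zero    h rewrite h refl = ℚ.*-zeroˡ 0ℚᵘ
frac-* a (suc b) h = ℚ.*≡* (≡.trans (ℤ.*-identityʳ _)
  (cong (+ a ℤ.*_) (≡.sym (cong (+_) (cong suc (ℕ.*-identityʳ b))))))

-- The default value 0 at `b = 0` can only lower the left side, which is harmless where irregularity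
-- is bounded from above.
frac-*-≤ : ∀ a b → frac a b * ℕ→ℚ b ≤ ℕ→ℚ a
frac-*-≤ a zero    = ℚ.≤-trans (ℚ.≤-reflexive (ℚ.*-zeroˡ 0ℚᵘ)) (ℕ→ℚ-mono {0} {a} ℕ.z≤n)
frac-*-≤ a (suc b) = ℚ.≤-reflexive (frac-* a (suc b) λ ())

module _ {n} (G : Graph n) where

  edge : Fin n → Fin n → ℚᵘ
  edge u v = 𝟙 (adj G u v)

  ∣A∣*∣B∣≡Σ : ∀ (A B : Subset n) →
    ∣ A ∣ ℕ.* ∣ B ∣ ≡ sumℕ n (λ u → sumℕ n (λ v → [ lookup A u ] ℕ.* [ lookup B v ]))
  ∣A∣*∣B∣≡Σ A B = ≡.trans (cong₂ ℕ._*_ (∣S∣≡Σ A) (∣S∣≡Σ B)) (ℕΣ.Σ-*-Σ n n _ _)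

  e≤∣A∣*∣B∣ : ∀ A B → e G A B ℕ.≤ ∣ A ∣ ℕ.* ∣ B ∣
  e≤∣A∣*∣B∣ A B rewrite ∣A∣*∣B∣≡Σ A B = sumℕ-mono n λ u → sumℕ-mono n λ v →
    bound (lookup A u) (lookup B v) (adj G u v)
    where
    bound : ∀ a b c → [ a ∧ (b ∧ c) ] ℕ.≤ [ a ] ℕ.* [ b ]
    bound true  true  c = []≤1 c
    bound true  false c = ℕ.z≤n
    bound false b     c = ℕ.z≤n

  -- For an empty set the default value of `frac` is right as well: `e G A B` vanishes together with
  -- the denominator.
  dens-* : ∀ A B → dens G A B * ℕ→ℚ (∣ A ∣ ℕ.* ∣ B ∣) ≃ ℕ→ℚ (e G A B)
  dens-* A B = frac-* (e G A B) _ λ ∣A∣∣B∣≡0 →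
    ℕ.n≤0⇒n≡0 (≡.subst (e G A B ℕ.≤_) ∣A∣∣B∣≡0 (e≤∣A∣*∣B∣ A B))

  0≤dens : ∀ A B → 0ℚᵘ ≤ dens G A B
  0≤dens A B with ∣ A ∣ ℕ.* ∣ B ∣
  ... | zero  = ℚ.≤-refl
  ... | suc m = ℚ.nonNegative⁻¹ (mkℚᵘ (+ e G A B) m)

  dens≤1 : ∀ A B → dens G A B ≤ 1ℚᵘ
  dens≤1 A B with ∣ A ∣ ℕ.* ∣ B ∣ | e≤∣A∣*∣B∣ A B
  ... | zero  | _ = ℚ.nonNegative⁻¹ 1ℚᵘ
  ... | suc m | e≤ = ℚ.*≤* (≡.subst₂ ℤ._≤_ (≡.sym (ℤ.*-identityʳ _)) (≡.sym (ℤ.*-identityˡ _)) (ℤ.+≤+ e≤))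

  ∣A∣*∣B∣≃Σ² : ∀ A B → ℕ→ℚ (∣ A ∣ ℕ.* ∣ B ∣) ≃ Σ² n (λ u v → 𝟙 (lookup A u) * 𝟙 (lookup B v))
  ∣A∣*∣B∣≃Σ² A B rewrite ∣A∣*∣B∣≡Σ A B = ℚ.≃-trans (ℕ→ℚ-Σ² n _)
    (Σ²-cong n λ u v → ℕ→ℚ-* [ lookup A u ] [ lookup B v ])

  e≃Σ² : ∀ A B → ℕ→ℚ (e G A B) ≃ Σ² n (λ u v → 𝟙 (lookup A u) * 𝟙 (lookup B v) * edge u v)
  e≃Σ² A B = ℚ.≃-trans (ℕ→ℚ-Σ² n _) (Σ²-cong n λ u v →
    split (lookup A u) (lookup B v) (adj G u v))
    where
    split : ∀ a b c → 𝟙 (a ∧ (b ∧ c)) ≃ 𝟙 a * 𝟙 b * 𝟙 c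
    split a b c = ℚ.≃-trans (𝟙-∧ a (b ∧ c)) (ℚ.≃-trans (ℚ.*-congˡ {𝟙 a} (𝟙-∧ b c))
      (ℚ.≃-sym (ℚ.*-assoc (𝟙 a) (𝟙 b) (𝟙 c))))

  -- Clearing the denominator makes a difference of densities linear in the indicators of A and B;
  -- all comparisons of densities go through this form.
  weighted-dev : ∀ A B c →
    ℕ→ℚ (∣ A ∣ ℕ.* ∣ B ∣) * (dens G A B - c) ≃
    Σ² n (λ u v → 𝟙 (lookup A u) * 𝟙 (lookup B v) * (edge u v - c))
  weighted-dev A B c = begin-equality
    x * (dens G A B - c)
      ≃⟨ solve 3 (λ x d c → x :* (d :- c) := d :* x :+ (:- c) :* x) ℚ.≃-refl x (dens G A B) c ⟩
    dens G A B * x + (- c) * x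
      ≃⟨ ℚ.+-cong (ℚ.≃-trans (dens-* A B) (e≃Σ² A B))
           (ℚ.≃-trans (ℚ.*-congˡ { - c} (∣A∣*∣B∣≃Σ² A B)) (Σ²-*ˡ n (- c) _)) ⟩
    Σ² n (λ u v → ab u v * edge u v) + Σ² n (λ u v → (- c) * ab u v)
      ≃⟨ Σ²-+ n _ _ ⟨
    Σ² n (λ u v → ab u v * edge u v + (- c) * ab u v)
      ≃⟨ Σ²-cong n (λ u v → solve 3 (λ x d c → x :* d :+ (:- c) :* x := x :* (d :- c))
           ℚ.≃-refl (ab u v) (edge u v) c) ⟩
    Σ² n (λ u v → ab u v * (edge u v - c)) ∎
    where
    open ℚ.≤-Reasoning
    x = ℕ→ℚ (∣ A ∣ ℕ.* ∣ B ∣)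
    ab : Fin n → Fin n → ℚᵘ
    ab u v = 𝟙 (lookup A u) * 𝟙 (lookup B v)

-- Energy and irregularity

module _ {n k} (G : Graph n) (P : Partition n k) where

  density : Fin n → Fin n → ℚᵘ
  density u v = dens G (cell P (part P u)) (cell P (part P v))

  energy : ℚᵘ
  energy = Σ² n (λ u v → density u v * density u v)

  deviation : Fin n → Fin n → ℚᵘ
  deviation u v = edge G u v - density u v

  ind-subst : ∀ i j u v (H : Fin k → Fin k → ℚᵘ) →
    ind P i j u v * H (part P u) (part P v) ≃ ind P i j u v * H i j
  ind-subst i j u v H with part P u ≟ i | part P v ≟ j
  ... | yes refl | yes refl = ℚ.≃-refl
  ... | yes refl | no _     = ℚ.≃-trans (ℚ.*-zeroˡ (H i (part P v))) (ℚ.≃-sym (ℚ.*-zeroˡ (H i j)))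
  ... | no _     | yes refl = ℚ.≃-trans (ℚ.*-zeroˡ (H (part P u) j)) (ℚ.≃-sym (ℚ.*-zeroˡ (H i j)))
  ... | no _     | no _     = ℚ.≃-trans (ℚ.*-zeroˡ (H (part P u) (part P v))) (ℚ.≃-sym (ℚ.*-zeroˡ (H i j)))

  Σ²-block-deviation : ∀ i j →
    Σ² n (λ u v → ind P i j u v * (edge G u v - dens G (cell P i) (cell P j))) ≃ 0ℚᵘ
  Σ²-block-deviation i j = begin-equality
    Σ² n (λ u v → ind P i j u v * (edge G u v - c))
      ≃⟨ Σ²-cong n (λ u v → ℚ.≃-reflexive (cong₂ (λ a b → 𝟙 a * 𝟙 b * (edge G u v - c))
           (lookup-cell P i u) (lookup-cell P j v))) ⟨
    Σ² n (λ u v → 𝟙 (lookup (cell P i) u) * 𝟙 (lookup (cell P j) v) * (edge G u v - c))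
      ≃⟨ weighted-dev G (cell P i) (cell P j) c ⟨
    x * (c - c)  ≃⟨ ℚ.*-congˡ {x} (ℚ.+-inverseʳ c) ⟩
    x * 0ℚᵘ      ≃⟨ ℚ.*-zeroʳ x ⟩
    0ℚᵘ          ∎
    where
    open ℚ.≤-Reasoning
    c = dens G (cell P i) (cell P j)
    x = ℕ→ℚ (∣ cell P i ∣ ℕ.* ∣ cell P j ∣)

  -- The density is the orthogonal projection of the edge indicator onto the functions constant on
  -- blocks: on the block of i and j, `g` is a constant and the deviation has sum 0.
  deviation-⊥-cells : ∀ (g : Fin k → Fin k → ℚᵘ) →
    Σ² n (λ u v → g (part P u) (part P v) * deviation u v) ≃ 0ℚᵘ
  deviation-⊥-cells g = begin-equality
    Σ² n (λ u v → g (part P u) (part P v) * deviation u v)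
      ≃⟨ Σ²-blocks P _ ⟩
    sumℚ k (λ i → sumℚ k (λ j → Σ² n (λ u v → ind P i j u v * (g (part P u) (part P v) * deviation u v))))
      ≃⟨ ℚΣ.Σ-cong k (λ i → ℚΣ.Σ-cong k (block i)) ⟩
    sumℚ k (λ i → sumℚ k (λ j → 0ℚᵘ))
      ≃⟨ ℚ.≃-trans (ℚΣ.Σ-cong k (λ i → ℚΣ.Σ-0 k)) (ℚΣ.Σ-0 k) ⟩
    0ℚᵘ ∎
    where
    open ℚ.≤-Reasoning
    δ : Fin k → Fin k → Fin n → Fin n → ℚᵘ
    δ i j u v = edge G u v - dens G (cell P i) (cell P j)
    block : ∀ i j → Σ² n (λ u v → ind P i j u v * (g (part P u) (part P v) * deviation u v)) ≃ 0ℚᵘ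
    block i j = begin-equality
      Σ² n (λ u v → ind P i j u v * (g (part P u) (part P v) * deviation u v))
        ≃⟨ Σ²-cong n (λ u v → ind-subst i j u v (λ a b → g a b * δ a b u v)) ⟩
      Σ² n (λ u v → ind P i j u v * (g i j * δ i j u v))
        ≃⟨ Σ²-cong n (λ u v → solve 3 (λ x y z → x :* (y :* z) := y :* (x :* z)) ℚ.≃-refl
             (ind P i j u v) (g i j) (δ i j u v)) ⟩
      Σ² n (λ u v → g i j * (ind P i j u v * δ i j u v))
        ≃⟨ Σ²-*ˡ n (g i j) _ ⟨
      g i j * Σ² n (λ u v → ind P i j u v * δ i j u v)
        ≃⟨ ℚ.*-congˡ {g i j} (Σ²-block-deviation i j) ⟩
      g i j * 0ℚᵘ
        ≃⟨ ℚ.*-zeroʳ (g i j) ⟩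
      0ℚᵘ ∎

  0≤density² : ∀ u v → 0ℚᵘ ≤ density u v * density u v
  0≤density² u v = ℚ.nonNegative⁻¹ _ {{ℚ.nonNeg*nonNeg⇒nonNeg (density u v) {{nn}} (density u v) {{nn}}}}
    where nn = ℚ.nonNegative (0≤dens G (cell P (part P u)) (cell P (part P v)))

  0≤energy : 0ℚᵘ ≤ energy
  0≤energy = ℚ.≤-trans
    (ℚ.≤-reflexive (ℚ.≃-sym (Σ²-0 n)))
    (Σ²-mono n 0≤density²)

  Σ²-1 : Σ² n (λ _ _ → 1ℚᵘ) ≃ ℕ→ℚ (n ℕ.* n)
  Σ²-1 = ℚ.≃-trans (ℚ.≃-sym (ℕ→ℚ-Σ² n (λ _ _ → 1))) (ℚ.≃-reflexive (cong ℕ→ℚ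
    (≡.trans (ℕΣ.Σ-cong n (λ u → sumℕ-const n 1))
      (≡.trans (sumℕ-const n (n ℕ.* 1)) (cong (n ℕ.*_) (ℕ.*-identityʳ n))))))

  energy≤n² : energy ≤ ℕ→ℚ (n ℕ.* n)
  energy≤n² = ℚ.≤-trans (Σ²-mono n λ u v →
      let d≤1 = dens≤1 G (cell P (part P u)) (cell P (part P v))
          nn = ℚ.nonNegative (0≤dens G (cell P (part P u)) (cell P (part P v)))
      in ℚ.*-mono-≤-nonNeg {{nn}} {{nn}} d≤1 d≤1)
    (ℚ.≤-reflexive Σ²-1)

  abs-deviation≤1 : ∀ u v → abs (deviation u v) ≤ 1ℚᵘ
  abs-deviation≤1 u v = bound (adj G u v) (0≤dens G A B) (dens≤1 G A B)
    where
    A = cell P (part P u)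
    B = cell P (part P v)
    bound : ∀ b {d} → 0ℚᵘ ≤ d → d ≤ 1ℚᵘ → abs (𝟙 b - d) ≤ 1ℚᵘ
    bound true {d} 0≤d d≤1 = begin
      abs (1ℚᵘ - d)  ≃⟨ ℚ.0≤p⇒∣p∣≃p (ℚ.p≤q⇒0≤q-p d≤1) ⟩
      1ℚᵘ - d        ≤⟨ ℚ.+-monoʳ-≤ 1ℚᵘ (ℚ.neg-mono-≤ 0≤d) ⟩
      1ℚᵘ - 0ℚᵘ      ≃⟨ ℚ.+-identityʳ 1ℚᵘ ⟩
      1ℚᵘ            ∎
      where open ℚ.≤-Reasoning
    bound false {d} 0≤d d≤1 = begin
      abs (0ℚᵘ - d)  ≃⟨ ℚ.∣-∣-cong (ℚ.+-identityˡ (- d)) ⟩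
      abs (- d)      ≃⟨ ℚ.∣-p∣≃∣p∣ d ⟩
      abs d          ≃⟨ ℚ.0≤p⇒∣p∣≃p 0≤d ⟩
      d              ≤⟨ d≤1 ⟩
      1ℚᵘ            ∎
      where open ℚ.≤-Reasoning

  -- The weight `∣ Si ∣ * ∣ Tj ∣` of a term cancels the denominator of `d(Si , Tj)`, and the
  -- remaining `∣ S ∣ * ∣ T ∣` is moved to the left. Each block keeps its own absolute value, so
  -- deviations of opposite sign in different blocks do not cancel.
  irregularity-*≤ : ∀ S T →
    irregularity G P S T * ℕ→ℚ (∣ S ∣ ℕ.* ∣ T ∣) ≤
    sumℚ k (λ i → sumℚ k (λ j → abs (Σ² n (λ u v →
      ind P i j u v * (𝟙 (lookup S u) * 𝟙 (lookup T v) * deviation u v)))))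
  irregularity-*≤ S T = begin
    irregularity G P S T * Y
      ≃⟨ ℚ.≃-trans (ℚΣ.Σ-*ʳ k Y _) (ℚΣ.Σ-cong k λ i → ℚΣ.Σ-*ʳ k Y _) ⟩
    sumℚ k (λ i → sumℚ k (λ j → frac (x i j) y * abs (z i j) * Y))
      ≤⟨ sumℚ-mono k (λ i → sumℚ-mono k (term i)) ⟩
    sumℚ k (λ i → sumℚ k (λ j → abs (Σ² n (λ u v →
      ind P i j u v * (𝟙 (lookup S u) * 𝟙 (lookup T v) * deviation u v))))) ∎
    where
    open ℚ.≤-Reasoning
    y = ∣ S ∣ ℕ.* ∣ T ∣
    Y = ℕ→ℚ y
    x : Fin k → Fin k → ℕ
    x i j = ∣ intersect S (cell P i) ∣ ℕ.* ∣ intersect T (cell P j) ∣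
    c z : Fin k → Fin k → ℚᵘ
    c i j = dens G (cell P i) (cell P j)
    z i j = dens G (intersect S (cell P i)) (intersect T (cell P j)) - c i j
    𝟙-intersect : ∀ (S : Subset n) i u →
      𝟙 (lookup (intersect S (cell P i)) u) ≃ 𝟙 (lookup S u) * 𝟙 ⌊ part P u ≟ i ⌋
    𝟙-intersect S i u = ℚ.≃-trans
      (ℚ.≃-reflexive (cong 𝟙 (≡.trans (lookup-intersect S (cell P i) u)
        (cong (lookup S u ∧_) (lookup-cell P i u)))))
      (𝟙-∧ (lookup S u) _)
    pointwise : ∀ i j u v →
      𝟙 (lookup (intersect S (cell P i)) u) * 𝟙 (lookup (intersect T (cell P j)) v) * (edge G u v - c i j)
      ≃ ind P i j u v * (𝟙 (lookup S u) * 𝟙 (lookup T v) * deviation u v)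
    pointwise i j u v = begin-equality
      𝟙 (lookup (intersect S (cell P i)) u) * 𝟙 (lookup (intersect T (cell P j)) v) * (edge G u v - c i j)
        ≃⟨ ℚ.*-congʳ {edge G u v - c i j} (ℚ.*-cong (𝟙-intersect S i u) (𝟙-intersect T j v)) ⟩
      s * α * (t * β) * (edge G u v - c i j)
        ≃⟨ solve 5 (λ s α t β r → s :* α :* (t :* β) :* r := α :* β :* (s :* t :* r)) ℚ.≃-refl
             s α t β (edge G u v - c i j) ⟩
      ind P i j u v * (s * t * (edge G u v - c i j))
        ≃⟨ ind-subst i j u v (λ a b → s * t * (edge G u v - c a b)) ⟨
      ind P i j u v * (s * t * deviation u v) ∎
      where
      s = 𝟙 (lookup S u)
      t = 𝟙 (lookup T v)
      α = 𝟙 ⌊ part P u ≟ i ⌋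
      β = 𝟙 ⌊ part P v ≟ j ⌋
    term : ∀ i j → frac (x i j) y * abs (z i j) * Y ≤ abs (Σ² n (λ u v →
      ind P i j u v * (𝟙 (lookup S u) * 𝟙 (lookup T v) * deviation u v)))
    term i j = begin
      frac (x i j) y * abs (z i j) * Y
        ≃⟨ solve 3 (λ f a y → f :* a :* y := f :* y :* a) ℚ.≃-refl (frac (x i j) y) (abs (z i j)) Y ⟩
      frac (x i j) y * Y * abs (z i j)
        -- Only an inequality, because S or T may be empty.
        ≤⟨ ℚ.*-monoˡ-≤-nonNeg (abs (z i j)) {{ℚ.nonNegative (ℚ.0≤∣p∣ (z i j))}} (frac-*-≤ (x i j) y) ⟩
      ℕ→ℚ (x i j) * abs (z i j)
        ≃⟨ ℚ.∣p*q∣≃∣p∣*∣q∣ (ℕ→ℚ (x i j)) (z i j) ⟨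
      abs (ℕ→ℚ (x i j) * z i j)
        ≃⟨ ℚ.∣-∣-cong (weighted-dev G (intersect S (cell P i)) (intersect T (cell P j)) (c i j)) ⟩
      abs (Σ² n (λ u v → 𝟙 (lookup (intersect S (cell P i)) u) *
        𝟙 (lookup (intersect T (cell P j)) v) * (edge G u v - c i j)))
        ≃⟨ ℚ.∣-∣-cong (Σ²-cong n (pointwise i j)) ⟩
      abs (Σ² n (λ u v → ind P i j u v * (𝟙 (lookup S u) * 𝟙 (lookup T v) * deviation u v))) ∎

  Σ-abs-blocks : ∀ (F : Fin n → Fin n → ℚᵘ) →
    sumℚ k (λ i → sumℚ k (λ j → abs (Σ² n (λ u v → ind P i j u v * F u v)))) ≤
    Σ² n (λ u v → abs (F u v))
  Σ-abs-blocks F = begin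
    sumℚ k (λ i → sumℚ k (λ j → abs (Σ² n (λ u v → ind P i j u v * F u v))))
      ≤⟨ sumℚ-mono k (λ i → sumℚ-mono k λ j → Σ²-abs n _) ⟩
    sumℚ k (λ i → sumℚ k (λ j → Σ² n (λ u v → abs (ind P i j u v * F u v))))
      ≃⟨ ℚΣ.Σ-cong k (λ i → ℚΣ.Σ-cong k λ j → Σ²-cong n λ u v → abs-ind i j u v) ⟩
    sumℚ k (λ i → sumℚ k (λ j → Σ² n (λ u v → ind P i j u v * abs (F u v))))
      ≃⟨ Σ²-blocks P _ ⟨
    Σ² n (λ u v → abs (F u v)) ∎
    where
    open ℚ.≤-Reasoning
    abs-ind : ∀ i j u v → abs (ind P i j u v * F u v) ≃ ind P i j u v * abs (F u v)
    abs-ind i j u v = ℚ.≃-trans (ℚ.∣p*q∣≃∣p∣*∣q∣ (ind P i j u v) (F u v))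
      (ℚ.*-congʳ {abs (F u v)} (ℚ.0≤p⇒∣p∣≃p (ℚ.≤-trans (ℕ→ℚ-mono {0} ℕ.z≤n)
        (ℚ.≤-reflexive (ℕ→ℚ-* [ ⌊ part P u ≟ i ⌋ ] [ ⌊ part P v ≟ j ⌋ ])))))

module _ {n k k′} (G : Graph n) (P : Partition n k) (P′ : Partition n k′)
  (r : Refines P′ P) where

  change : Fin n → Fin n → ℚᵘ
  change u v = density G P′ u v - density G P u v

  -- The change is the deviation from the old density minus the deviation from the new one. The old
  -- density is constant on the old blocks and, by refinement, on the new ones, so it is orthogonal
  -- to both.
  density-⊥-change : Σ² n (λ u v → density G P u v * change u v) ≃ 0ℚᵘ
  density-⊥-change = begin-equality
    Σ² n (λ u v → d u v * change u v)
      ≃⟨ Σ²-cong n (λ u v → solve 3 (λ a d d′ → d :* (d′ :- d) := d :* (a :- d) :+ :- con 1ℚᵘ :* (d :* (a :- d′)))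
           ℚ.≃-refl (edge G u v) (d u v) (density G P′ u v)) ⟩
    Σ² n (λ u v → d u v * deviation G P u v + (- 1ℚᵘ) * (d u v * deviation G P′ u v))
      ≃⟨ Σ²-+ n _ _ ⟩
    Σ² n (λ u v → d u v * deviation G P u v) + Σ² n (λ u v → (- 1ℚᵘ) * (d u v * deviation G P′ u v))
      ≃⟨ ℚ.+-cong (deviation-⊥-cells G P (λ i j → dens G (cell P i) (cell P j)))
           (ℚ.≃-sym (Σ²-*ˡ n (- 1ℚᵘ) _)) ⟩
    0ℚᵘ + (- 1ℚᵘ) * Σ² n (λ u v → d u v * deviation G P′ u v)
      ≃⟨ ℚ.+-congʳ 0ℚᵘ (ℚ.*-congˡ { - 1ℚᵘ} (ℚ.≃-trans
           (Σ²-cong n λ u v → ℚ.≃-reflexive (cong₂ (λ i j → dens G (cell P i) (cell P j) * deviation G P′ u v)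
             (refines u) (refines v)))
           (deviation-⊥-cells G P′ (λ i j → dens G (cell P (f i)) (cell P (f j)))))) ⟩
    0ℚᵘ + (- 1ℚᵘ) * 0ℚᵘ  ≃⟨ ℚ.*≡* refl ⟩
    0ℚᵘ ∎
    where
    open ℚ.≤-Reasoning
    d = density G P
    f = proj₁ r
    refines = proj₂ r

  energy-pythagoras : energy G P + Σ² n (λ u v → change u v * change u v) ≃ energy G P′
  energy-pythagoras = begin-equality
    energy G P + Σ² n (λ u v → h u v * h u v)
      ≃⟨ Σ²-+ n _ _ ⟨
    Σ² n (λ u v → d u v * d u v + h u v * h u v)
      ≃⟨ Σ²-cong n (λ u v → solve 2 (λ d d′ → d :* d :+ (d′ :- d) :* (d′ :- d)
           := d′ :* d′ :+ :- con (ℕ→ℚ 2) :* (d :* (d′ :- d))) ℚ.≃-refl (d u v) (d′ u v)) ⟩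
    Σ² n (λ u v → d′ u v * d′ u v + (- ℕ→ℚ 2) * (d u v * h u v))
      ≃⟨ Σ²-+ n _ _ ⟩
    energy G P′ + Σ² n (λ u v → (- ℕ→ℚ 2) * (d u v * h u v))
      ≃⟨ ℚ.+-congʳ (energy G P′) (ℚ.≃-trans (ℚ.≃-sym (Σ²-*ˡ n (- ℕ→ℚ 2) _))
           (ℚ.*-congˡ { - ℕ→ℚ 2} density-⊥-change)) ⟩
    energy G P′ + (- ℕ→ℚ 2) * 0ℚᵘ
      ≃⟨ ℚ.≃-trans (ℚ.+-congʳ (energy G P′) (ℚ.*-zeroʳ (- ℕ→ℚ 2))) (ℚ.+-identityʳ (energy G P′)) ⟩
    energy G P′ ∎
    where
    open ℚ.≤-Reasoning
    d = density G P
    d′ = density G P′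
    h = change

  -- With a the edge indicator, w that of S × T and w° its approximation by new cells, `w(a - d) =
  -- w°(a - d′) + w°(d′ - d) + (w - w°)(a - d)`. The first summand has sum 0 on every old block, so
  -- it disappears before absolute values are taken; the other two are bounded by `abs (change u v)`
  -- and `E u v`.
  irregularity≤change : ∀ (S T : Subset n) (σ τ : Fin k′ → Bool) (E : Fin n → Fin n → ℚᵘ) →
    (∀ u v → abs (𝟙 (lookup S u) * 𝟙 (lookup T v) - 𝟙 (σ (part P′ u)) * 𝟙 (τ (part P′ v))) ≤ E u v) →
    irregularity G P S T * ℕ→ℚ (∣ S ∣ ℕ.* ∣ T ∣) ≤ Σ² n (λ u v → abs (change u v)) + Σ² n E
  irregularity≤change S T σ τ E E-bound = begin
    irregularity G P S T * ℕ→ℚ (∣ S ∣ ℕ.* ∣ T ∣)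
      ≤⟨ irregularity-*≤ G P S T ⟩
    sumℚ k (λ i → sumℚ k (λ j → abs (Σ² n (λ u v → ind P i j u v * (w u v * deviation G P u v)))))
      ≃⟨ ℚΣ.Σ-cong k (λ i → ℚΣ.Σ-cong k λ j → ℚ.∣-∣-cong (block i j)) ⟩
    sumℚ k (λ i → sumℚ k (λ j → abs (Σ² n (λ u v → ind P i j u v * F u v))))
      ≤⟨ Σ-abs-blocks G P F ⟩
    Σ² n (λ u v → abs (F u v))
      ≤⟨ Σ²-mono n F-bound ⟩
    Σ² n (λ u v → abs (change u v) + E u v)
      ≃⟨ Σ²-+ n _ _ ⟩
    Σ² n (λ u v → abs (change u v)) + Σ² n E ∎
    where
    open ℚ.≤-Reasoning
    f = proj₁ r
    refines = proj₂ r
    w w° F : Fin n → Fin n → ℚᵘ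
    w u v = 𝟙 (lookup S u) * 𝟙 (lookup T v)
    w° u v = 𝟙 (σ (part P′ u)) * 𝟙 (τ (part P′ v))
    F u v = w° u v * change u v + (w u v - w° u v) * deviation G P u v
    -- By refinement the indicator of an old block is a function of the new cells; hence so is its
    -- product with w°, and orthogonality applies block by block.
    ind′ : Fin k → Fin k → Fin k′ → Fin k′ → ℚᵘ
    ind′ i j a b = 𝟙 ⌊ f a ≟ i ⌋ * 𝟙 ⌊ f b ≟ j ⌋ * (𝟙 (σ a) * 𝟙 (τ b))
    block : ∀ i j → Σ² n (λ u v → ind P i j u v * (w u v * deviation G P u v)) ≃
      Σ² n (λ u v → ind P i j u v * F u v)
    block i j = begin-equality
      Σ² n (λ u v → ind P i j u v * (w u v * deviation G P u v))
        ≃⟨ Σ²-cong n (λ u v → solve 6 (λ x w w° a d d′ → x :* (w :* (a :- d)) :=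
             x :* w° :* (a :- d′) :+ x :* (w° :* (d′ :- d) :+ (w :- w°) :* (a :- d))) ℚ.≃-refl
             (ind P i j u v) (w u v) (w° u v) (edge G u v) (density G P u v) (density G P′ u v)) ⟩
      Σ² n (λ u v → ind P i j u v * w° u v * deviation G P′ u v + ind P i j u v * F u v)
        ≃⟨ Σ²-+ n _ _ ⟩
      Σ² n (λ u v → ind P i j u v * w° u v * deviation G P′ u v) + Σ² n (λ u v → ind P i j u v * F u v)
        ≃⟨ ℚ.+-congˡ (Σ² n (λ u v → ind P i j u v * F u v)) (ℚ.≃-trans
             (Σ²-cong n λ u v → ℚ.≃-reflexive (cong₂
               (λ a b → 𝟙 ⌊ a ≟ i ⌋ * 𝟙 ⌊ b ≟ j ⌋ * w° u v * deviation G P′ u v) (refines u) (refines v)))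
             (deviation-⊥-cells G P′ (ind′ i j))) ⟩
      0ℚᵘ + Σ² n (λ u v → ind P i j u v * F u v)
        ≃⟨ ℚ.+-identityˡ _ ⟩
      Σ² n (λ u v → ind P i j u v * F u v) ∎
    w°≤1 : ∀ u v → abs (w° u v) ≤ 1ℚᵘ
    w°≤1 u v = begin
      abs (w° u v)        ≃⟨ ℚ.∣-∣-cong (𝟙-∧ (σ (part P′ u)) (τ (part P′ v))) ⟨
      abs (𝟙 (σ (part P′ u) ∧ τ (part P′ v)))  ≤⟨ ℕ→ℚ-mono ([]≤1 (σ (part P′ u) ∧ τ (part P′ v))) ⟩
      1ℚᵘ ∎
    F-bound : ∀ u v → abs (F u v) ≤ abs (change u v) + E u v
    F-bound u v = begin
      abs (F u v)
        ≤⟨ ℚ.∣p+q∣≤∣p∣+∣q∣ (w° u v * change u v) ((w u v - w° u v) * deviation G P u v) ⟩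
      abs (w° u v * change u v) + abs ((w u v - w° u v) * deviation G P u v)
        ≃⟨ ℚ.+-cong (ℚ.∣p*q∣≃∣p∣*∣q∣ (w° u v) (change u v))
             (ℚ.∣p*q∣≃∣p∣*∣q∣ (w u v - w° u v) (deviation G P u v)) ⟩
      abs (w° u v) * abs (change u v) + abs (w u v - w° u v) * abs (deviation G P u v)
        ≤⟨ ℚ.+-mono-≤
             (ℚ.*-monoˡ-≤-nonNeg (abs (change u v)) {{ℚ.nonNegative (ℚ.0≤∣p∣ (change u v))}} (w°≤1 u v))
             (ℚ.*-monoʳ-≤-nonNeg (abs (w u v - w° u v)) {{ℚ.nonNegative (ℚ.0≤∣p∣ (w u v - w° u v))}}
               (abs-deviation≤1 G P u v)) ⟩
      1ℚᵘ * abs (change u v) + abs (w u v - w° u v) * 1ℚᵘ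
        ≃⟨ ℚ.+-cong (ℚ.*-identityˡ (abs (change u v))) (ℚ.*-identityʳ (abs (w u v - w° u v))) ⟩
      abs (change u v) + abs (w u v - w° u v)
        ≤⟨ ℚ.+-monoʳ-≤ (abs (change u v)) (E-bound u v) ⟩
      abs (change u v) + E u v ∎

-- Cutting the cells of an equipartition

sumℕ-append : ∀ a b (g : ℕ → ℕ) →
  sumℕ (a ℕ.+ b) (g ∘ toℕ) ≡ sumℕ a (g ∘ toℕ) ℕ.+ sumℕ b (λ x → g (a ℕ.+ toℕ x))
sumℕ-append zero    b g = refl
sumℕ-append (suc a) b g =
  ≡.trans (cong (g 0 ℕ.+_) (sumℕ-append a b (g ∘ suc))) (≡.sym (ℕ.+-assoc (g 0) _ _))

sumℕ-telescope : ∀ n (f : ℕ → ℕ) →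
  sumℕ n (λ x → f (suc (toℕ x))) ℕ.+ f 0 ≡ sumℕ n (f ∘ toℕ) ℕ.+ f n
sumℕ-telescope zero    f = refl
sumℕ-telescope (suc n) f = begin
  f 1 ℕ.+ Σ″ ℕ.+ f 0                ≡⟨ ℕ.+-comm (f 1 ℕ.+ Σ″) (f 0) ⟩
  f 0 ℕ.+ (f 1 ℕ.+ Σ″)              ≡⟨ cong (f 0 ℕ.+_) (ℕ.+-comm (f 1) Σ″) ⟩
  f 0 ℕ.+ (Σ″ ℕ.+ f 1)              ≡⟨ cong (f 0 ℕ.+_) (sumℕ-telescope n (f ∘ suc)) ⟩
  f 0 ℕ.+ (sumℕ n (f ∘ suc ∘ toℕ) ℕ.+ f (suc n))  ≡⟨ ℕ.+-assoc (f 0) _ _ ⟨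
  f 0 ℕ.+ sumℕ n (f ∘ suc ∘ toℕ) ℕ.+ f (suc n)    ∎
  where
  open ≡.≡-Reasoning
  Σ″ = sumℕ n (λ x → f (suc (suc (toℕ x))))

[m+n]/n≡1+m/n : ∀ m t → (m ℕ.+ suc t) ℕ./ suc t ≡ suc (m ℕ./ suc t)
[m+n]/n≡1+m/n m t = ≡.trans (ℕ.+-distrib-/-∣ʳ m (n∣n {suc t}))
  (≡.trans (cong (m ℕ./ suc t ℕ.+_) (ℕ.n/n≡1 (suc t))) (ℕ.+-comm _ 1))

-- Hermite's identity; it provides block lengths that add up to exactly m. Raising m by 1 shifts the
-- list of summands by one place: the first, `m / (t+1)`, is lost and `(m + t + 1) / (t+1)`, which
-- is larger by 1, is gained.
hermite : ∀ t m → sumℕ (suc t) (λ x → (m ℕ.+ toℕ x) ℕ./ suc t) ≡ m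
hermite t zero    = ≡.trans (ℕΣ.Σ-cong (suc t) λ x → ℕ.m<n⇒m/n≡0 (Fin.toℕ<n x)) (ℕΣ.Σ-0 (suc t))
hermite t (suc m) = ℕ.+-cancelʳ-≡ (m ℕ./ suc t) _ _ (begin
  sumℕ (suc t) (λ x → (suc m ℕ.+ toℕ x) ℕ./ suc t) ℕ.+ m ℕ./ suc t
    ≡⟨ cong₂ ℕ._+_ (ℕΣ.Σ-cong (suc t) (λ x → cong (ℕ._/ suc t) (≡.sym (ℕ.+-suc m (toℕ x)))))
         (cong (ℕ._/ suc t) (≡.sym (ℕ.+-identityʳ m))) ⟩
  sumℕ (suc t) (λ x → f (suc (toℕ x))) ℕ.+ f 0
    ≡⟨ sumℕ-telescope (suc t) f ⟩
  sumℕ (suc t) (f ∘ toℕ) ℕ.+ (m ℕ.+ suc t) ℕ./ suc t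
    ≡⟨ cong₂ ℕ._+_ (hermite t m) ([m+n]/n≡1+m/n m t) ⟩
  m ℕ.+ suc (m ℕ./ suc t)
    ≡⟨ ℕ.+-suc m _ ⟩
  suc m ℕ.+ m ℕ./ suc t ∎)
  where
  open ≡.≡-Reasoning
  f : ℕ → ℕ
  f x = (m ℕ.+ x) ℕ./ suc t

count : ∀ {n} → (Fin n → Bool) → ℕ
count {n} A = sumℕ n ([_] ∘ A)

count-witness : ∀ {n} (A : Fin n → Bool) → 0 ℕ.< count A → Σ (Fin n) λ u → A u ≡ true
count-witness {suc n} A pos with A zero in eq
... | true  = zero , eq
... | false with count-witness (A ∘ suc) pos
...   | u , Au = suc u , Au

rank : ∀ {n} → (Fin n → Bool) → Fin n → ℕ
rank A zero    = 0
rank A (suc u) = [ A zero ] ℕ.+ rank (A ∘ suc) u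

rank<count : ∀ {n} (A : Fin n → Bool) u → A u ≡ true → rank A u ℕ.< count A
rank<count A zero    Au rewrite Au = ℕ.s≤s ℕ.z≤n
rank<count A (suc u) Au = ℕ.+-monoʳ-< [ A zero ] (rank<count (A ∘ suc) u Au)

-- A change of summation variable takes the place of the bijection between the members of `A` and
-- the numbers below `count A`; no inverse map has to be built, and sizes follow by summing
-- indicators.
sum-rank : ∀ {n} (A : Fin n → Bool) (g : ℕ → ℕ) →
  sumℕ n (λ u → [ A u ] ℕ.* g (rank A u)) ≡ sumℕ (count A) (g ∘ toℕ)
sum-rank {zero}  A g = refl
sum-rank {suc n} A g with A zero
... | true  = cong₂ ℕ._+_ (ℕ.+-identityʳ (g 0)) (sum-rank (A ∘ suc) (g ∘ suc))
... | false = sum-rank (A ∘ suc) g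

-- Index of the interval containing x when intervals of lengths `ℓ 0`, `ℓ 1`, ... are laid end to
-- end. The last one absorbs every larger x, so a boundary at the very end of a cell also has a
-- block.
block : ∀ {t} → (Fin (suc t) → ℕ) → ℕ → Fin (suc t)
block {zero}  ℓ x = zero
block {suc t} ℓ x with x ℕ.<? ℓ zero
... | yes _ = zero
... | no  _ = suc (block (ℓ ∘ suc) (x ℕ.∸ ℓ zero))

block-< : ∀ {t} (ℓ : Fin (suc t) → ℕ) {x} → x ℕ.< ℓ zero → block ℓ x ≡ zero
block-< {zero}  ℓ x<ℓ₀ = refl
block-< {suc t} ℓ {x} x<ℓ₀ with x ℕ.<? ℓ zero
... | yes _   = refl
... | no x≮ℓ₀ = contradiction x<ℓ₀ x≮ℓ₀

block-+ : ∀ {t} (ℓ : Fin (suc (suc t)) → ℕ) x → block ℓ (ℓ zero ℕ.+ x) ≡ suc (block (ℓ ∘ suc) x)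
block-+ ℓ x with ℓ zero ℕ.+ x ℕ.<? ℓ zero
... | yes bad = contradiction bad (ℕ.m+n≮m (ℓ zero) x)
... | no _    = cong (suc ∘ block (ℓ ∘ suc)) (ℕ.m+n∸m≡n (ℓ zero) x)

block-mono : ∀ {t} (ℓ : Fin (suc t) → ℕ) {x y} → x ℕ.≤ y → block ℓ x Fin.≤ block ℓ y
block-mono {zero}  ℓ x≤y = ℕ.z≤n
block-mono {suc t} ℓ {x} {y} x≤y with x ℕ.<? ℓ zero | y ℕ.<? ℓ zero
... | yes _   | _       = ℕ.z≤n
... | no x≮ℓ₀ | yes y<ℓ₀ = contradiction (ℕ.≤-<-trans x≤y y<ℓ₀) x≮ℓ₀
... | no _    | no _    = ℕ.s≤s (block-mono (ℓ ∘ suc) (ℕ.∸-monoˡ-≤ (ℓ zero) x≤y))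

sum-block : ∀ {t} (ℓ : Fin (suc t) → ℕ) (g : Fin (suc t) → ℕ) →
  sumℕ (sumℕ (suc t) ℓ) (λ x → g (block ℓ (toℕ x))) ≡ sumℕ (suc t) (λ j → ℓ j ℕ.* g j)
sum-block {t} ℓ g = begin
  sumℕ (ℓ zero ℕ.+ sumℕ t (ℓ ∘ suc)) (λ x → g (block ℓ (toℕ x)))
    ≡⟨ sumℕ-append (ℓ zero) _ (g ∘ block ℓ) ⟩
  sumℕ (ℓ zero) (λ x → g (block ℓ (toℕ x))) ℕ.+ sumℕ (sumℕ t (ℓ ∘ suc)) (λ x → g (block ℓ (ℓ zero ℕ.+ toℕ x)))
    ≡⟨ cong₂ ℕ._+_
         (≡.trans (ℕΣ.Σ-cong (ℓ zero) λ x → cong g (block-< ℓ (Fin.toℕ<n x))) (sumℕ-const (ℓ zero) (g zero)))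
         (later t ℓ g) ⟩
  ℓ zero ℕ.* g zero ℕ.+ sumℕ t (λ j → ℓ (suc j) ℕ.* g (suc j)) ∎
  where
  open ≡.≡-Reasoning
  later : ∀ t (ℓ g : Fin (suc t) → ℕ) →
    sumℕ (sumℕ t (ℓ ∘ suc)) (λ x → g (block ℓ (ℓ zero ℕ.+ toℕ x))) ≡
    sumℕ t (λ j → ℓ (suc j) ℕ.* g (suc j))
  later zero    ℓ g = refl
  later (suc t) ℓ g = ≡.trans
    (ℕΣ.Σ-cong (sumℕ (suc t) (ℓ ∘ suc)) λ x → cong g (block-+ ℓ (toℕ x)))
    (sum-block (ℓ ∘ suc) (g ∘ suc))

[]-mono : ∀ a b → (a ≡ true → b ≡ true) → [ a ] ℕ.≤ [ b ]
[]-mono true  b h rewrite h refl = ℕ.≤-refl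
[]-mono false b h = ℕ.z≤n

⌊⌋-true : ∀ {a} {A : Set a} (d : Dec A) → A → ⌊ d ⌋ ≡ true
⌊⌋-true (yes _) _ = refl
⌊⌋-true (no ¬a) a = contradiction a ¬a

⌊⌋-sound : ∀ {a} {A : Set a} (d : Dec A) → ⌊ d ⌋ ≡ true → A
⌊⌋-sound (yes a) _ = a

-- Applied to the block of a vertex and the boundary block, in either order: strict inequality puts
-- the vertex into the approximating union, and equality lets the boundary block pay for what the
-- union misses.
[]≤[<]+[≡] : ∀ {n} {a b : Fin n} s e → (s ≡ true → a Fin.≤ b) → (a ≡ b → e ≡ true) →
  [ s ] ℕ.≤ [ ⌊ a Fin.<? b ⌋ ] ℕ.+ [ e ]
[]≤[<]+[≡] false e h₁ h₂ = ℕ.z≤n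
[]≤[<]+[≡] {a = a} {b} true e h₁ h₂ with a Fin.<? b
... | yes _  = ℕ.m≤m+n 1 [ e ]
... | no a≮b rewrite h₂ (Fin.≤-antisym (h₁ refl) (ℕ.≮⇒≥ a≮b)) = ℕ.≤-refl

sum-cells : ∀ {n k} (P : Partition n k) → sumℕ k (λ i → ∣ cell P i ∣) ≡ n
sum-cells {n} {k} P = begin
  sumℕ k (λ i → ∣ cell P i ∣)
    ≡⟨ ℕΣ.Σ-cong k (λ i → ≡.trans (∣S∣≡Σ (cell P i))
         (ℕΣ.Σ-cong n λ u → ≡.trans (cong [_] (lookup-cell P i u)) (≡.sym (ℕ.*-identityʳ _)))) ⟩
  sumℕ k (λ i → sumℕ n (λ u → [ ⌊ part P u ≟ i ⌋ ] ℕ.* 1))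
    ≡⟨ ℕΣ.Σ-fibres (part P) (λ _ → 1) ⟨
  sumℕ n (λ _ → 1)  ≡⟨ sumℕ-const n 1 ⟩
  n ℕ.* 1           ≡⟨ ℕ.*-identityʳ n ⟩
  n                 ∎
  where open ≡.≡-Reasoning

-- Each cell is listed as S, then the rest, then T, and cut into consecutive blocks of almost equal
-- length, so that S and T are unions of blocks up to a single block per cell each.
module Refinement {n k} (t : ℕ) (P : Partition n k) (equi : IsEquipartition P)
  (large : ∀ i → suc t ℕ.≤ ∣ cell P i ∣) (S T : Subset n) where

  inS inR inT : Fin k → Fin n → Bool
  inS i u = ⌊ part P u ≟ i ⌋ ∧ lookup S u
  inR i u = ⌊ part P u ≟ i ⌋ ∧ (not (lookup S u) ∧ not (lookup T u))
  inT i u = ⌊ part P u ≟ i ⌋ ∧ (not (lookup S u) ∧ lookup T u)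

  endS startT : Fin k → ℕ
  endS i = count (inS i)
  startT i = endS i ℕ.+ count (inR i)

  position : Fin k → Fin n → ℕ
  position i u =
    if lookup S u then rank (inS i) u else
    if lookup T u then startT i ℕ.+ rank (inT i) u else
    endS i ℕ.+ rank (inR i) u

  -- The three colour classes fill consecutive intervals, so `position i` enumerates the cell
  -- without gaps; as with `sum-rank`, this is expressed by sums.
  sum-position′ : ∀ i (g : ℕ → ℕ) →
    sumℕ n (λ u → [ ⌊ part P u ≟ i ⌋ ] ℕ.* g (position i u)) ≡
    sumℕ (startT i ℕ.+ count (inT i)) (g ∘ toℕ)
  sum-position′ i g = begin
    sumℕ n (λ u → [ ⌊ part P u ≟ i ⌋ ] ℕ.* g (position i u))
      ≡⟨ ℕΣ.Σ-cong n (λ u → by-colour ⌊ part P u ≟ i ⌋ (lookup S u) (lookup T u)) ⟩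
    sumℕ n (λ u → [ inS i u ] ℕ.* g (rank (inS i) u) ℕ.+ [ inR i u ] ℕ.* g (endS i ℕ.+ rank (inR i) u)
      ℕ.+ [ inT i u ] ℕ.* g (startT i ℕ.+ rank (inT i) u))
      ≡⟨ ≡.trans (ℕΣ.Σ-+ n _ _) (cong (ℕ._+ sumℕ n (λ u → [ inT i u ] ℕ.* g (startT i ℕ.+ rank (inT i) u))) (ℕΣ.Σ-+ n _ _)) ⟩
    sumℕ n (λ u → [ inS i u ] ℕ.* g (rank (inS i) u)) ℕ.+
    sumℕ n (λ u → [ inR i u ] ℕ.* g (endS i ℕ.+ rank (inR i) u)) ℕ.+
    sumℕ n (λ u → [ inT i u ] ℕ.* g (startT i ℕ.+ rank (inT i) u))
      ≡⟨ cong₂ ℕ._+_ (cong₂ ℕ._+_ (sum-rank (inS i) g) (sum-rank (inR i) (g ∘ (endS i ℕ.+_))))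
           (sum-rank (inT i) (g ∘ (startT i ℕ.+_))) ⟩
    sumℕ (endS i) (g ∘ toℕ) ℕ.+ sumℕ (count (inR i)) (λ x → g (endS i ℕ.+ toℕ x)) ℕ.+
    sumℕ (count (inT i)) (λ x → g (startT i ℕ.+ toℕ x))
      ≡⟨ cong (ℕ._+ sumℕ (count (inT i)) (λ x → g (startT i ℕ.+ toℕ x)))
           (sumℕ-append (endS i) (count (inR i)) g) ⟨
    sumℕ (startT i) (g ∘ toℕ) ℕ.+ sumℕ (count (inT i)) (λ x → g (startT i ℕ.+ toℕ x))
      ≡⟨ sumℕ-append (startT i) (count (inT i)) g ⟨
    sumℕ (startT i ℕ.+ count (inT i)) (g ∘ toℕ) ∎
    where
    open ≡.≡-Reasoning
    by-colour : ∀ c s t {x y z} →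
      [ c ] ℕ.* g (if s then x else if t then z else y) ≡
      [ c ∧ s ] ℕ.* g x ℕ.+ [ c ∧ (not s ∧ not t) ] ℕ.* g y ℕ.+ [ c ∧ (not s ∧ t) ] ℕ.* g z
    by-colour true  true  t     = ≡.sym (≡.trans (ℕ.+-identityʳ _) (ℕ.+-identityʳ _))
    by-colour true  false true  = refl
    by-colour true  false false = ≡.sym (ℕ.+-identityʳ _)
    by-colour false s     t     = refl

  ∣cell∣≡ : ∀ i → ∣ cell P i ∣ ≡ startT i ℕ.+ count (inT i)
  ∣cell∣≡ i = begin
    ∣ cell P i ∣
      ≡⟨ ∣S∣≡Σ (cell P i) ⟩
    sumℕ n (λ u → [ lookup (cell P i) u ])
      ≡⟨ ℕΣ.Σ-cong n (λ u → ≡.trans (cong [_] (lookup-cell P i u)) (≡.sym (ℕ.*-identityʳ _))) ⟩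
    sumℕ n (λ u → [ ⌊ part P u ≟ i ⌋ ] ℕ.* 1)
      ≡⟨ sum-position′ i (λ _ → 1) ⟩
    sumℕ m (λ _ → 1)  ≡⟨ sumℕ-const m 1 ⟩
    m ℕ.* 1           ≡⟨ ℕ.*-identityʳ m ⟩
    m                 ∎
    where
    open ≡.≡-Reasoning
    m = startT i ℕ.+ count (inT i)

  size : Fin k → Fin (suc t) → ℕ
  size i x = (∣ cell P i ∣ ℕ.+ toℕ x) ℕ./ suc t

  block-of : Fin k → ℕ → Fin (suc t)
  block-of i = block (size i)

  sum-block-of : ∀ i (g : Fin (suc t) → ℕ) →
    sumℕ n (λ u → [ ⌊ part P u ≟ i ⌋ ] ℕ.* g (block-of i (position i u))) ≡
    sumℕ (suc t) (λ j → size i j ℕ.* g j)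
  sum-block-of i g = begin
    sumℕ n (λ u → [ ⌊ part P u ≟ i ⌋ ] ℕ.* g (block-of i (position i u)))
      ≡⟨ sum-position′ i (g ∘ block-of i) ⟩
    sumℕ (startT i ℕ.+ count (inT i)) (λ x → g (block-of i (toℕ x)))
      ≡⟨ cong (λ m → sumℕ m (λ x → g (block-of i (toℕ x))))
           (≡.trans (≡.sym (∣cell∣≡ i)) (≡.sym (hermite t ∣ cell P i ∣))) ⟩
    sumℕ (sumℕ (suc t) (size i)) (λ x → g (block-of i (toℕ x)))
      ≡⟨ sum-block (size i) g ⟩
    sumℕ (suc t) (λ j → size i j ℕ.* g j) ∎
    where open ≡.≡-Reasoning

  part′ : Fin n → Fin (k ℕ.* suc t)
  part′ u = combine (part P u) (block-of (part P u) (position (part P u) u))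

  sum-one-block : ∀ i (j : Fin (suc t)) →
    sumℕ n (λ u → [ ⌊ part P u ≟ i ⌋ ] ℕ.* [ ⌊ j ≟ block-of i (position i u) ⌋ ]) ≡ size i j
  sum-one-block i j = begin
    sumℕ n (λ u → [ ⌊ part P u ≟ i ⌋ ] ℕ.* [ ⌊ j ≟ block-of i (position i u) ⌋ ])
      ≡⟨ sum-block-of i (λ x → [ ⌊ j ≟ x ⌋ ]) ⟩
    sumℕ (suc t) (λ x → size i x ℕ.* [ ⌊ j ≟ x ⌋ ])
      ≡⟨ ℕΣ.Σ-cong (suc t) (λ x → ℕ.*-comm (size i x) [ ⌊ j ≟ x ⌋ ]) ⟩
    sumℕ (suc t) (λ x → [ ⌊ j ≟ x ⌋ ] ℕ.* size i x)
      ≡⟨ ℕΣ.Σ-pick (suc t) j (size i) ⟩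
    size i j ∎
    where open ≡.≡-Reasoning

  count-part′ : ∀ i j → count (λ u → ⌊ part′ u ≟ combine i j ⌋) ≡ size i j
  count-part′ i j = ≡.trans (ℕΣ.Σ-cong n pointwise) (sum-one-block i j)
    where
    pointwise : ∀ u → [ ⌊ part′ u ≟ combine i j ⌋ ] ≡
      [ ⌊ part P u ≟ i ⌋ ] ℕ.* [ ⌊ j ≟ block-of i (position i u) ⌋ ]
    pointwise u with part′ u ≟ combine i j | part P u ≟ i
    ... | yes eq | no ≢i = contradiction (Fin.combine-injectiveˡ _ _ i j eq) ≢i
    ... | no _   | no _  = refl
    ... | yes eq | yes refl with j ≟ block-of i (position i u)
    ...   | yes _ = refl
    ...   | no ≢j = contradiction (≡.sym (Fin.combine-injectiveʳ i _ i j eq)) ≢j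
    pointwise u | no ≢ | yes refl with j ≟ block-of i (position i u)
    ...   | yes refl = contradiction refl ≢
    ...   | no _     = refl

  -- The numerator is at least `suc t` by `large`; this makes every block a legitimate nonempty
  -- part.
  0<size : ∀ i j → 0 ℕ.< size i j
  0<size i j = ℕ.m≥n⇒m/n>0 (ℕ.≤-trans (large i) (ℕ.m≤m+n _ _))

  refinement : Partition n (k ℕ.* suc t)
  refinement .part = part′
  refinement .nonempty c with Fin.combine-surjective {k} c
  ... | i , j , refl with count-witness (λ u → ⌊ part′ u ≟ combine i j ⌋)
                           (≡.subst (0 ℕ.<_) (≡.sym (count-part′ i j)) (0<size i j))
  ...   | u , eq = u , ⌊⌋-sound (part′ u ≟ combine i j) eq

  ∣cell-refinement∣ : ∀ i j → ∣ cell refinement (combine i j) ∣ ≡ size i j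
  ∣cell-refinement∣ i j = ≡.trans (∣S∣≡Σ (cell refinement (combine i j)))
    (≡.trans (ℕΣ.Σ-cong n λ u → cong [_] (lookup-cell refinement (combine i j) u)) (count-part′ i j))

  size≤ : ∀ i j → size i j ℕ.≤ suc (∣ cell P i ∣ ℕ./ suc t)
  size≤ i j = begin
    (∣ cell P i ∣ ℕ.+ toℕ j) ℕ./ suc t  ≤⟨ ℕ./-monoˡ-≤ (suc t) (ℕ.+-monoʳ-≤ ∣ cell P i ∣ (ℕ.<⇒≤ (Fin.toℕ<n j))) ⟩
    (∣ cell P i ∣ ℕ.+ suc t) ℕ./ suc t  ≡⟨ [m+n]/n≡1+m/n ∣ cell P i ∣ t ⟩
    suc (∣ cell P i ∣ ℕ./ suc t)        ∎
    where open ℕ.≤-Reasoning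

  -- Since `j ≤ t`, there is room for the extra vertex of a larger cell: `m ≤ m′ + 1` gives
  -- `m + j ≤ m′ + (t + 1)`, and division by `t + 1` yields at most one more than the least block
  -- size of the other cell.
  refinement-equi : IsEquipartition refinement
  refinement-equi c c′ with Fin.combine-surjective {k} c | Fin.combine-surjective {k} c′
  ... | i , j , refl | i′ , j′ , refl
    rewrite ∣cell-refinement∣ i j | ∣cell-refinement∣ i′ j′ = begin
    (∣ cell P i ∣ ℕ.+ toℕ j) ℕ./ suc t
      ≤⟨ ℕ./-monoˡ-≤ (suc t) (ℕ.+-monoˡ-≤ (toℕ j) (equi i i′)) ⟩
    (suc ∣ cell P i′ ∣ ℕ.+ toℕ j) ℕ./ suc t
      ≡⟨ cong (ℕ._/ suc t) (≡.sym (ℕ.+-suc ∣ cell P i′ ∣ (toℕ j))) ⟩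
    (∣ cell P i′ ∣ ℕ.+ suc (toℕ j)) ℕ./ suc t
      ≤⟨ ℕ./-monoˡ-≤ (suc t) (ℕ.+-monoʳ-≤ ∣ cell P i′ ∣ (Fin.toℕ<n j)) ⟩
    (∣ cell P i′ ∣ ℕ.+ suc t) ℕ./ suc t
      ≡⟨ [m+n]/n≡1+m/n ∣ cell P i′ ∣ t ⟩
    suc (∣ cell P i′ ∣ ℕ./ suc t)
      ≤⟨ ℕ.s≤s (ℕ./-monoˡ-≤ (suc t) (ℕ.m≤m+n ∣ cell P i′ ∣ (toℕ j′))) ⟩
    suc ((∣ cell P i′ ∣ ℕ.+ toℕ j′) ℕ./ suc t) ∎
    where open ℕ.≤-Reasoning

  refinement-refines : Refines refinement P
  refinement-refines = proj₁ ∘ remQuot {k} (suc t) ,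
    λ u → ≡.sym (cong proj₁ (Fin.remQuot-combine {k} (part P u) _))

  -- Marks, in each cell, the one block that contains the boundary position `x i`. Only there can S
  -- or T differ from a union of blocks.
  pivot : (Fin k → ℕ) → Fin n → Bool
  pivot x u = ⌊ block-of (part P u) (x (part P u)) ≟ block-of (part P u) (position (part P u) u) ⌋

  -- A block of a cell of size m has at most `1 + m/(t+1)` vertices, and `t+1` times this is at most
  -- 2m because `t+1 ≤ m`. There is one pivot block per cell, and the cells add up to n.
  count-pivot : ∀ x → suc t ℕ.* count (pivot x) ℕ.≤ 2 ℕ.* n
  count-pivot x = begin
    suc t ℕ.* count (pivot x)
      ≡⟨ cong (suc t ℕ.*_) (≡.trans (ℕΣ.Σ-fibres (part P) ([_] ∘ pivot x))
           (ℕΣ.Σ-cong k λ i → ≡.trans (ℕΣ.Σ-cong n (pointwise i)) (sum-one-block i (block-of i (x i))))) ⟩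
    suc t ℕ.* sumℕ k (λ i → size i (block-of i (x i)))
      ≡⟨ ℕΣ.Σ-*ˡ k (suc t) _ ⟩
    sumℕ k (λ i → suc t ℕ.* size i (block-of i (x i)))
      ≤⟨ sumℕ-mono k (λ i → bound i (block-of i (x i))) ⟩
    sumℕ k (λ i → 2 ℕ.* ∣ cell P i ∣)
      ≡⟨ ≡.trans (≡.sym (ℕΣ.Σ-*ˡ k 2 _)) (cong (2 ℕ.*_) (sum-cells P)) ⟩
    2 ℕ.* n ∎
    where
    open ℕ.≤-Reasoning
    pointwise : ∀ i u → [ ⌊ part P u ≟ i ⌋ ] ℕ.* [ pivot x u ] ≡
      [ ⌊ part P u ≟ i ⌋ ] ℕ.* [ ⌊ block-of i (x i) ≟ block-of i (position i u) ⌋ ]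
    pointwise i u with part P u ≟ i
    ... | yes refl = refl
    ... | no _     = refl
    bound : ∀ i j → suc t ℕ.* size i j ℕ.≤ 2 ℕ.* ∣ cell P i ∣
    bound i j = begin
      suc t ℕ.* size i j
        ≤⟨ ℕ.*-monoʳ-≤ (suc t) (size≤ i j) ⟩
      suc t ℕ.* suc (∣ cell P i ∣ ℕ./ suc t)
        ≡⟨ ℕ.*-suc (suc t) _ ⟩
      suc t ℕ.+ suc t ℕ.* (∣ cell P i ∣ ℕ./ suc t)
        ≤⟨ ℕ.+-mono-≤ (large i) (ℕ.≤-trans (ℕ.≤-reflexive (ℕ.*-comm (suc t) _)) (ℕ.m/n*n≤m ∣ cell P i ∣ (suc t))) ⟩
      ∣ cell P i ∣ ℕ.+ ∣ cell P i ∣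
        ≡⟨ cong (∣ cell P i ∣ ℕ.+_) (ℕ.+-identityʳ _) ⟨
      2 ℕ.* ∣ cell P i ∣ ∎

  -- Strict inequalities leave out the boundary block and so give approximations from inside; the
  -- error is then one-sided and can be counted in ℕ.
  σ′ τ′ : Fin k × Fin (suc t) → Bool
  σ′ (i , j) = ⌊ j Fin.<? block-of i (endS i) ⌋
  τ′ (i , j) = ⌊ block-of i (startT i) Fin.<? j ⌋

  σ τ : Fin (k ℕ.* suc t) → Bool
  σ = σ′ ∘ remQuot {k} (suc t)
  τ = τ′ ∘ remQuot {k} (suc t)

  in-cell : ∀ u {b} → b ≡ true → ⌊ part P u ≟ part P u ⌋ ∧ b ≡ true
  in-cell u refl rewrite ⌊⌋-true (part P u ≟ part P u) refl = refl

  S⇒position< : ∀ u → lookup S u ≡ true → position (part P u) u ℕ.< endS (part P u)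
  S⇒position< u s rewrite s = rank<count (inS (part P u)) u (in-cell u s)

  position<⇒S : ∀ u → position (part P u) u ℕ.< endS (part P u) → lookup S u ≡ true
  position<⇒S u p< with lookup S u | lookup T u
  ... | true  | _     = refl
  ... | false | true  = contradiction (ℕ.m+n≤o⇒m≤o _ (ℕ.m+n≤o⇒m≤o _ p<)) (ℕ.<⇒≱ (ℕ.n<1+n _))
  ... | false | false = contradiction p< (ℕ.m+n≮m _ _)

  -- Disjointness enters here, because `position` lists a common vertex of S and T with S.
  T⇒≤position : Disjoint S T → ∀ u → lookup T u ≡ true → startT (part P u) ℕ.≤ position (part P u) u
  T⇒≤position disjoint u t with lookup S u in s
  ... | true  = contradiction (lookup⇒[]= u T t) (disjoint u (lookup⇒[]= u S s))
  ... | false rewrite t = ℕ.m≤m+n _ _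

  ≤position⇒T : ∀ u → startT (part P u) ℕ.≤ position (part P u) u → lookup T u ≡ true
  ≤position⇒T u ≤p with lookup S u in s | lookup T u in t
  ... | _     | true  = refl
  ... | true  | false = contradiction (ℕ.≤-trans (ℕ.m≤m+n _ _) ≤p)
    (ℕ.<⇒≱ (rank<count (inS (part P u)) u (in-cell u s)))
  ... | false | false = contradiction (ℕ.+-cancelˡ-≤ (endS (part P u)) _ _ ≤p)
    (ℕ.<⇒≱ (rank<count (inR (part P u)) u (in-cell u (cong₂ (λ a b → not a ∧ not b) s t))))

  σ-part′ : ∀ u → σ (part′ u) ≡ σ′ (part P u , block-of (part P u) (position (part P u) u))
  σ-part′ u = cong σ′ (Fin.remQuot-combine {k} (part P u) _)

  τ-part′ : ∀ u → τ (part′ u) ≡ τ′ (part P u , block-of (part P u) (position (part P u) u))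
  τ-part′ u = cong τ′ (Fin.remQuot-combine {k} (part P u) _)

  -- By monotonicity of `block`, a position at or after `endS` would lie in the pivot block or a
  -- later one.
  σ≤S : ∀ u → [ σ (part′ u) ] ℕ.≤ [ lookup S u ]
  σ≤S u = []-mono _ _ λ σu → position<⇒S u (ℕ.≰⇒> λ end≤p →
    ℕ.<⇒≱ (⌊⌋-sound (_ Fin.<? _) (≡.trans (≡.sym (σ-part′ u)) σu))
          (block-mono (size (part P u)) end≤p))

  τ≤T : ∀ u → [ τ (part′ u) ] ℕ.≤ [ lookup T u ]
  τ≤T u = []-mono _ _ λ τu → ≤position⇒T u (ℕ.<⇒≤ (ℕ.≰⇒> λ p≤start →
    ℕ.<⇒≱ (⌊⌋-sound (_ Fin.<? _) (≡.trans (≡.sym (τ-part′ u)) τu))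
          (block-mono (size (part P u)) p≤start)))

  S≤σ : ∀ u → [ lookup S u ] ℕ.≤ [ σ (part′ u) ] ℕ.+ [ pivot endS u ]
  S≤σ u = ≡.subst (λ b → [ lookup S u ] ℕ.≤ [ b ] ℕ.+ [ pivot endS u ]) (≡.sym (σ-part′ u))
    ([]≤[<]+[≡] (lookup S u) (pivot endS u)
      (λ s → block-mono (size (part P u)) (ℕ.<⇒≤ (S⇒position< u s)))
      (λ eq → ⌊⌋-true (_ ≟ _) (≡.sym eq)))

  T≤τ : Disjoint S T → ∀ u → [ lookup T u ] ℕ.≤ [ τ (part′ u) ] ℕ.+ [ pivot startT u ]
  T≤τ disjoint u = ≡.subst (λ b → [ lookup T u ] ℕ.≤ [ b ] ℕ.+ [ pivot startT u ]) (≡.sym (τ-part′ u))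
    ([]≤[<]+[≡] (lookup T u) (pivot startT u)
      (λ t → block-mono (size (part P u)) (T⇒≤position disjoint u t))
      (⌊⌋-true (_ ≟ _)))

-- Iteration

0≤p*p : ∀ p → 0ℚᵘ ≤ p * p
0≤p*p p with ℚ.≤-total 0ℚᵘ p
... | inj₁ 0≤p = ℚ.nonNegative⁻¹ _ {{ℚ.nonNeg*nonNeg⇒nonNeg p {{nn}} p {{nn}}}}
  where nn = ℚ.nonNegative 0≤p
... | inj₂ p≤0 = ℚ.≤-trans
  (ℚ.nonNegative⁻¹ _ {{ℚ.nonNeg*nonNeg⇒nonNeg (- p) {{nn}} (- p) {{nn}}}})
  (ℚ.≤-reflexive (solve 1 (λ p → (:- p) :* (:- p) := p :* p) ℚ.≃-refl p))
  where nn = ℚ.nonNegative (ℚ.neg-mono-≤ p≤0)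

abs-square : ∀ p → abs p * abs p ≃ p * p
abs-square p = ℚ.≃-trans (ℚ.≃-sym (ℚ.∣p*q∣≃∣p∣*∣q∣ p p)) (ℚ.0≤p⇒∣p∣≃p (0≤p*p p))

-- A pointwise form of Cauchy-Schwarz: `2K|h| ≤ K²h² + 1` summed over the n² pairs gives
-- `2n² ≤ K² Σ h² + n²`, and `Σ h²` is the gain of energy by Pythagoras.
energy-increment : ∀ {n k k′} (G : Graph n) (P : Partition n k) (P′ : Partition n k′)
  (r : Refines P′ P) K →
  ℕ→ℚ (n ℕ.* n) ≤ ℕ→ℚ K * Σ² n (λ u v → abs (change G P P′ r u v)) →
  ℕ→ℚ (K ℕ.* K) * energy G P + ℕ→ℚ (n ℕ.* n) ≤ ℕ→ℚ (K ℕ.* K) * energy G P′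
energy-increment {n} G P P′ r K n²≤KH = begin
  ℕ→ℚ (K ℕ.* K) * energy G P + N²
    ≃⟨ ℚ.+-congˡ N² (ℚ.*-congʳ {energy G P} (ℕ→ℚ-* K K)) ⟩
  κ * κ * energy G P + N²
    ≤⟨ ℚ.+-monoʳ-≤ (κ * κ * energy G P) n²≤K²Σh² ⟩
  κ * κ * energy G P + κ * κ * Σ² n (λ u v → h u v * h u v)
    ≃⟨ ℚ.*-distribˡ-+ (κ * κ) (energy G P) _ ⟨
  κ * κ * (energy G P + Σ² n (λ u v → h u v * h u v))
    ≃⟨ ℚ.*-cong (ℚ.≃-sym (ℕ→ℚ-* K K)) (energy-pythagoras G P P′ r) ⟩
  ℕ→ℚ (K ℕ.* K) * energy G P′ ∎
  where
  open ℚ.≤-Reasoning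
  κ = ℕ→ℚ K
  N² = ℕ→ℚ (n ℕ.* n)
  h = change G P P′ r
  H = Σ² n (λ u v → abs (h u v))
  -- 0 ≤ (K|h| - 1)²
  am-gm : ∀ u v → ℕ→ℚ 2 * κ * abs (h u v) ≤ κ * κ * (h u v * h u v) + 1ℚᵘ
  am-gm u v = begin
    ℕ→ℚ 2 * κ * x
      ≃⟨ ℚ.+-identityʳ _ ⟨
    ℕ→ℚ 2 * κ * x + 0ℚᵘ
      ≤⟨ ℚ.+-monoʳ-≤ (ℕ→ℚ 2 * κ * x) (0≤p*p (κ * x - 1ℚᵘ)) ⟩
    ℕ→ℚ 2 * κ * x + (κ * x - 1ℚᵘ) * (κ * x - 1ℚᵘ)
      ≃⟨ solve 2 (λ κ x → con (ℕ→ℚ 2) :* κ :* x :+ (κ :* x :- con 1ℚᵘ) :* (κ :* x :- con 1ℚᵘ)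
           := κ :* κ :* (x :* x) :+ con 1ℚᵘ) ℚ.≃-refl κ x ⟩
    κ * κ * (x * x) + 1ℚᵘ
      ≃⟨ ℚ.+-congˡ 1ℚᵘ (ℚ.*-congˡ {κ * κ} (abs-square (h u v))) ⟩
    κ * κ * (h u v * h u v) + 1ℚᵘ ∎
    where x = abs (h u v)
  n²≤K²Σh² : N² ≤ κ * κ * Σ² n (λ u v → h u v * h u v)
  n²≤K²Σh² = ≤-cancel (begin
    N² + N²
      ≤⟨ ℚ.+-mono-≤ n²≤KH n²≤KH ⟩
    κ * H + κ * H
      ≃⟨ solve 2 (λ κ H → κ :* H :+ κ :* H := con (ℕ→ℚ 2) :* κ :* H) ℚ.≃-refl κ H ⟩
    ℕ→ℚ 2 * κ * H
      ≃⟨ Σ²-*ˡ n (ℕ→ℚ 2 * κ) _ ⟩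
    Σ² n (λ u v → ℕ→ℚ 2 * κ * abs (h u v))
      ≤⟨ Σ²-mono n am-gm ⟩
    Σ² n (λ u v → κ * κ * (h u v * h u v) + 1ℚᵘ)
      ≃⟨ Σ²-+ n _ _ ⟩
    Σ² n (λ u v → κ * κ * (h u v * h u v)) + Σ² n (λ _ _ → 1ℚᵘ)
      ≃⟨ ℚ.+-cong (ℚ.≃-sym (Σ²-*ˡ n (κ * κ) _)) (Σ²-1 G P) ⟩
    κ * κ * Σ² n (λ u v → h u v * h u v) + N² ∎)
    where
    ≤-cancel : ∀ {x y z} → x + z ≤ y + z → x ≤ y
    ≤-cancel {x} {y} {z} x+z≤y+z = begin
      x            ≃⟨ solve 2 (λ x z → x := x :+ z :+ :- z) ℚ.≃-refl x z ⟩
      x + z + - z  ≤⟨ ℚ.+-monoˡ-≤ (- z) x+z≤y+z ⟩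
      y + z + - z  ≃⟨ solve 2 (λ x z → x :+ z :+ :- z := x) ℚ.≃-refl y z ⟩
      y            ∎

-- The threshold is 1/N with denominators cleared. In this form the condition is decidable, so a
-- finite search over pairs of subsets either finds a violation or proves regularity constructively.
Violation : ∀ {n k} → ℕ → Graph n → Partition n k → Subset n → Subset n → Set
Violation {n} N G P S T = Disjoint S T × n ℕ.≤ N ℕ.* ∣ S ∣ × n ℕ.≤ N ℕ.* ∣ T ∣ ×
  1ℚᵘ < ℕ→ℚ N * irregularity G P S T

violation? : ∀ {n k} N (G : Graph n) (P : Partition n k) S T → Dec (Violation N G P S T)
violation? {n} N G P S T =
  Fin.all? (λ v → (v ∈? S) →-dec ¬? (v ∈? T)) ×-dec (n ℕ.≤? N ℕ.* ∣ S ∣) ×-dec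
  (n ℕ.≤? N ℕ.* ∣ T ∣) ×-dec (1ℚᵘ ℚ.<? ℕ→ℚ N * irregularity G P S T)

Regular : ∀ {n k} → ℕ → Graph n → Partition n k → Set
Regular N G P = ∀ S T → ¬ Violation N G P S T

ℕ→ℚ-pos : ∀ N .{{_ : ℕ.NonZero N}} → ℚ.Positive (ℕ→ℚ N)
ℕ→ℚ-pos (suc _) = _

-- As `1/N ≤ ε`, sets that are large for ε are large for 1/N, and the bound 1/N on the irregularity
-- is the stronger one.
regular⇒weakRegular : ∀ {n k} N .{{_ : ℕ.NonZero N}} (G : Graph n) (P : Partition n k) {ε} →
  1ℚᵘ ≤ ℕ→ℚ N * ε → Regular N G P → WeakRegular G ε P
regular⇒weakRegular {n} N G P {ε} 1≤Nε regular S T disjoint largeS largeT =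
  ℚ.*-cancelˡ-≤-pos (ℕ→ℚ N) {{ℕ→ℚ-pos N}} (ℚ.≤-trans (ℚ.≮⇒≥ λ bad →
    regular S T (disjoint , scale S largeS , scale T largeT , bad)) 1≤Nε)
  where
  scale : ∀ (S : Subset n) → ε * ℕ→ℚ n ≤ ℕ→ℚ ∣ S ∣ → n ℕ.≤ N ℕ.* ∣ S ∣
  scale S εn≤∣S∣ = ℕ→ℚ-cancel-≤ (begin
    ℕ→ℚ n                          ≃⟨ ℚ.*-identityˡ (ℕ→ℚ n) ⟨
    1ℚᵘ * ℕ→ℚ n                    ≤⟨ ℚ.*-monoˡ-≤-nonNeg (ℕ→ℚ n) 1≤Nε ⟩
    ℕ→ℚ N * ε * ℕ→ℚ n        ≃⟨ ℚ.*-assoc (ℕ→ℚ N) ε (ℕ→ℚ n) ⟩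
    ℕ→ℚ N * (ε * ℕ→ℚ n)      ≤⟨ ℚ.*-monoʳ-≤-nonNeg (ℕ→ℚ N) εn≤∣S∣ ⟩
    ℕ→ℚ N * ℕ→ℚ ∣ S ∣        ≃⟨ ℕ→ℚ-* N ∣ S ∣ ⟨
    ℕ→ℚ (N ℕ.* ∣ S ∣)          ∎)
    where open ℚ.≤-Reasoning

-- Two factors N come from the sizes of S and T, the third from the irregularity exceeding 1/N.
violation-bound : ∀ {n k} N (G : Graph n) (P : Partition n k) S T → Violation N G P S T →
  ℕ→ℚ (n ℕ.* n) ≤ ℕ→ℚ (N ℕ.* (N ℕ.* N)) * (irregularity G P S T * ℕ→ℚ (∣ S ∣ ℕ.* ∣ T ∣))
violation-bound {n} N G P S T (_ , largeS , largeT , 1<NI) = begin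
  ℕ→ℚ (n ℕ.* n)
    ≤⟨ ℕ→ℚ-mono (ℕ.≤-trans (ℕ.*-mono-≤ largeS largeT)
         (ℕ.≤-reflexive (rearrange N ∣ S ∣ ∣ T ∣))) ⟩
  ℕ→ℚ (N ℕ.* N ℕ.* y)
    ≃⟨ ℚ.*-identityʳ (ℕ→ℚ (N ℕ.* N ℕ.* y)) ⟨
  ℕ→ℚ (N ℕ.* N ℕ.* y) * 1ℚᵘ
    ≤⟨ ℚ.*-monoʳ-≤-nonNeg (ℕ→ℚ (N ℕ.* N ℕ.* y)) (ℚ.<⇒≤ 1<NI) ⟩
  ℕ→ℚ (N ℕ.* N ℕ.* y) * (ℕ→ℚ N * I)
    ≃⟨ ℚ.*-congʳ {ℕ→ℚ N * I} (ℕ→ℚ-* (N ℕ.* N) y) ⟩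
  ℕ→ℚ (N ℕ.* N) * ℕ→ℚ y * (ℕ→ℚ N * I)
    ≃⟨ solve 4 (λ a y b i → a :* y :* (b :* i) := b :* a :* (i :* y)) ℚ.≃-refl
         (ℕ→ℚ (N ℕ.* N)) (ℕ→ℚ y) (ℕ→ℚ N) I ⟩
  ℕ→ℚ N * ℕ→ℚ (N ℕ.* N) * (I * ℕ→ℚ y)
    ≃⟨ ℚ.*-congʳ {I * ℕ→ℚ y} (ℕ→ℚ-* N (N ℕ.* N)) ⟨
  ℕ→ℚ (N ℕ.* (N ℕ.* N)) * (I * ℕ→ℚ y) ∎
  where
  open ℚ.≤-Reasoning
  I = irregularity G P S T
  y = ∣ S ∣ ℕ.* ∣ T ∣
  rearrange : ∀ N s t → N ℕ.* s ℕ.* (N ℕ.* t) ≡ N ℕ.* N ℕ.* (s ℕ.* t)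
  rearrange = solve-∀

-- A cell with at most t vertices would force every cell of the equipartition to have at most
-- `t + 1`, too few for n vertices.
large-cells : ∀ {n k} t (P : Partition n k) → IsEquipartition P → ¬ n ℕ.≤ k ℕ.* suc t →
  ∀ i → suc t ℕ.≤ ∣ cell P i ∣
large-cells {n} {k} t P equi n≰kt i = ℕ.≮⇒≥ λ small → n≰kt (begin
  n                              ≡⟨ sum-cells P ⟨
  sumℕ k (λ j → ∣ cell P j ∣)    ≤⟨ sumℕ-mono k (λ j → ℕ.≤-trans (equi j i) small) ⟩
  sumℕ k (λ j → suc t)           ≡⟨ sumℕ-const k (suc t) ⟩
  k ℕ.* suc t                    ∎)
  where open ℕ.≤-Reasoning

-- The partition into singletons

singletons : ∀ n → Partition n n
singletons n .part = id
singletons n .nonempty v = v , refl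

singletons-equi : ∀ n → IsEquipartition (singletons n)
singletons-equi n i j = ℕ.≤-trans (ℕ.≤-reflexive ∣cell∣≡1) (ℕ.s≤s ℕ.z≤n)
  where
  sym-≟ : ∀ u → ⌊ u ≟ i ⌋ ≡ ⌊ i ≟ u ⌋
  sym-≟ u with u ≟ i
  ... | yes refl = ≡.sym (⌊⌋-true (i ≟ i) refl)
  ... | no u≢i with i ≟ u
  ...   | yes i≡u = contradiction (≡.sym i≡u) u≢i
  ...   | no _    = refl
  ∣cell∣≡1 : ∣ cell (singletons n) i ∣ ≡ 1
  ∣cell∣≡1 = ≡.trans (∣S∣≡Σ (cell (singletons n) i)) (≡.trans
    (ℕΣ.Σ-cong n λ u → ≡.trans (cong [_] (≡.trans (lookup-cell (singletons n) i u) (sym-≟ u)))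
      (≡.sym (ℕ.*-identityʳ _)))
    (ℕΣ.Σ-pick n i (λ _ → 1)))

-- Every S and T is an exact union of singletons, so `irregularity≤change` with the partition as its
-- own refinement has no change and no error. A violation would give `n² ≤ 0`; this is absurd only
-- for positive n, hence the separate case 0, where the irregularity is an empty sum.
singletons-regular : ∀ n N (G : Graph n) → Regular N G (singletons n)
singletons-regular zero N G S T (_ , _ , _ , 1<N*0) =
  ℚ.<⇒≱ 1<N*0 (ℚ.≤-trans (ℚ.≤-reflexive (ℚ.*-zeroʳ (ℕ→ℚ N))) (ℚ.nonNegative⁻¹ 1ℚᵘ))
singletons-regular n@(suc _) N G S T violation =
  contradiction (ℕ→ℚ-cancel-≤ {n ℕ.* n} {0} n²≤0) λ ()
  where
  open ℚ.≤-Reasoning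
  P = singletons n
  cancel : ∀ x → abs (x - x) ≃ 0ℚᵘ
  cancel x = ℚ.∣-∣-cong (ℚ.+-inverseʳ x)
  n²≤0 : ℕ→ℚ (n ℕ.* n) ≤ 0ℚᵘ
  n²≤0 = begin
    ℕ→ℚ (n ℕ.* n)
      ≤⟨ violation-bound N G P S T violation ⟩
    ℕ→ℚ (N ℕ.* (N ℕ.* N)) * (irregularity G P S T * ℕ→ℚ (∣ S ∣ ℕ.* ∣ T ∣))
      ≤⟨ ℚ.*-monoʳ-≤-nonNeg (ℕ→ℚ (N ℕ.* (N ℕ.* N)))
           (irregularity≤change G P P (id , λ _ → refl) S T (lookup S) (lookup T) (λ _ _ → 0ℚᵘ)
             (λ u v → ℚ.≤-reflexive (cancel (𝟙 (lookup S u) * 𝟙 (lookup T v))))) ⟩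
    ℕ→ℚ (N ℕ.* (N ℕ.* N)) * (Σ² n (λ u v → abs (density G P u v - density G P u v)) + Σ² n (λ _ _ → 0ℚᵘ))
      ≃⟨ ℚ.*-congˡ {ℕ→ℚ (N ℕ.* (N ℕ.* N))} (ℚ.+-cong
           (ℚ.≃-trans (Σ²-cong n λ u v → cancel (density G P u v)) (Σ²-0 n)) (Σ²-0 n)) ⟩
    ℕ→ℚ (N ℕ.* (N ℕ.* N)) * (0ℚᵘ + 0ℚᵘ)
      ≃⟨ ℚ.*-zeroʳ (ℕ→ℚ (N ℕ.* (N ℕ.* N))) ⟩
    0ℚᵘ ∎

abs-difference : ∀ a b e → b ℕ.≤ a → a ℕ.≤ b ℕ.+ e → abs (ℕ→ℚ a - ℕ→ℚ b) ≤ ℕ→ℚ e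
abs-difference a b e b≤a a≤b+e = begin
  abs (ℕ→ℚ a - ℕ→ℚ b)            ≃⟨ ℚ.0≤p⇒∣p∣≃p (ℚ.p≤q⇒0≤q-p (ℕ→ℚ-mono b≤a)) ⟩
  ℕ→ℚ a - ℕ→ℚ b                  ≤⟨ ℚ.+-monoˡ-≤ (- ℕ→ℚ b) (ℕ→ℚ-mono a≤b+e) ⟩
  ℕ→ℚ (b ℕ.+ e) - ℕ→ℚ b          ≃⟨ ℚ.+-congˡ (- ℕ→ℚ b) (ℕ→ℚ-+ b e) ⟩
  ℕ→ℚ b + ℕ→ℚ e - ℕ→ℚ b          ≃⟨ solve 2 (λ b e → b :+ e :- b := e) ℚ.≃-refl (ℕ→ℚ b) (ℕ→ℚ e) ⟩
  ℕ→ℚ e                          ∎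
  where open ℚ.≤-Reasoning

-- A pair in S × T that the approximation misses has u in the pivot block of S or v in that of T.
product-error : ∀ s σ p t τ q → [ s ] ℕ.≤ [ σ ] ℕ.+ [ p ] → [ t ] ℕ.≤ [ τ ] ℕ.+ [ q ] →
  [ s ] ℕ.* [ t ] ℕ.≤ [ σ ] ℕ.* [ τ ] ℕ.+ ([ p ] ℕ.+ [ q ])
product-error false σ p t τ q _ _ = ℕ.z≤n
product-error true σ p false τ q _ _ = ℕ.z≤n
product-error true true  p true true  q _ _ = ℕ.s≤s ℕ.z≤n
product-error true true  p true false q _ t≤ = ℕ.≤-trans t≤ (ℕ.m≤n+m [ q ] [ p ])
product-error true false p true τ     q s≤ _ = ℕ.≤-trans s≤ (ℕ.m≤m+n [ p ] [ q ])

-- The refinement step and its repetition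

module _ (N : ℕ) where

  -- `scale` doubles the N³ of `violation-bound` so that half of the irregularity may be lost to the
  -- error. The two pivot sets have at most `2n / (4 scale)` vertices each, which makes the error at
  -- most `n² / scale`. A round gains `n² / scale²` of energy, so `scale² + 1` rounds would exceed
  -- the maximum n².
  scale branching-1 branching steps : ℕ
  scale = 2 ℕ.* (N ℕ.* (N ℕ.* N))
  branching-1 = 4 ℕ.* scale
  branching = suc branching-1
  steps = suc (scale ℕ.* scale)

  Increment : ∀ {n k} → Graph n → Partition n k → Set
  Increment {n} {k} G P = Σ (Partition n (k ℕ.* branching)) λ P′ → IsEquipartition P′ × Refines P′ P ×
    ℕ→ℚ (scale ℕ.* scale) * energy G P + ℕ→ℚ (n ℕ.* n) ≤ ℕ→ℚ (scale ℕ.* scale) * energy G P′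

  violation⇒increment : ∀ {n k} (G : Graph n) (P : Partition n k) → IsEquipartition P →
    (∀ i → branching ℕ.≤ ∣ cell P i ∣) → ∀ S T → Violation N G P S T →
    Increment G P
  violation⇒increment {n} G P equi large S T violation@(disjoint , _) =
    refinement , refinement-equi , refinement-refines ,
    energy-increment G P refinement refinement-refines scale n²≤KH
    where
    open Refinement branching-1 P equi large S T
    a = count (pivot endS)
    b = count (pivot startT)
    error : Fin n → Fin n → ℕ
    error u v = [ pivot endS u ] ℕ.+ [ pivot startT v ]
    error-bound : ∀ u v → abs (𝟙 (lookup S u) * 𝟙 (lookup T v) -
      𝟙 (σ (part refinement u)) * 𝟙 (τ (part refinement v))) ≤ ℕ→ℚ (error u v)
    error-bound u v = ℚ.≤-trans
      (ℚ.≤-reflexive (ℚ.∣-∣-cong (ℚ.+-cong (ℚ.≃-sym (ℕ→ℚ-* [ lookup S u ] [ lookup T v ]))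
        (ℚ.-‿cong (ℚ.≃-sym (ℕ→ℚ-* [ σ (part′ u) ] [ τ (part′ v) ]))))))
      (abs-difference ([ lookup S u ] ℕ.* [ lookup T v ]) ([ σ (part′ u) ] ℕ.* [ τ (part′ v) ]) (error u v)
        (ℕ.*-mono-≤ (σ≤S u) (τ≤T v))
        (product-error (lookup S u) (σ (part′ u)) (pivot endS u) (lookup T v) (τ (part′ v)) (pivot startT v)
          (S≤σ u) (T≤τ disjoint v)))
    total-error : sumℕ n (λ u → sumℕ n (error u)) ≡ n ℕ.* (a ℕ.+ b)
    total-error = begin
      sumℕ n (λ u → sumℕ n (error u))
        ≡⟨ ℕΣ.Σ-cong n (λ u → ≡.trans (ℕΣ.Σ-+ n _ _) (cong (ℕ._+ b) (sumℕ-const n [ pivot endS u ]))) ⟩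
      sumℕ n (λ u → n ℕ.* [ pivot endS u ] ℕ.+ b)
        ≡⟨ ℕΣ.Σ-+ n _ _ ⟩
      sumℕ n (λ u → n ℕ.* [ pivot endS u ]) ℕ.+ sumℕ n (λ _ → b)
        ≡⟨ cong₂ ℕ._+_ (≡.sym (ℕΣ.Σ-*ˡ n n _)) (sumℕ-const n b) ⟩
      n ℕ.* a ℕ.+ n ℕ.* b
        ≡⟨ ℕ.*-distribˡ-+ n a b ⟨
      n ℕ.* (a ℕ.+ b) ∎
      where open ≡.≡-Reasoning
    small : ∀ x → 4 ℕ.* scale ℕ.* count (pivot x) ℕ.≤ 2 ℕ.* n
    small x = ℕ.≤-trans (ℕ.*-monoˡ-≤ (count (pivot x)) (ℕ.n≤1+n (4 ℕ.* scale))) (count-pivot x)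
    scaled-error : scale ℕ.* (n ℕ.* (a ℕ.+ b)) ℕ.≤ n ℕ.* n
    scaled-error = ℕ.*-cancelˡ-≤ 4 (begin
      4 ℕ.* (scale ℕ.* (n ℕ.* (a ℕ.+ b)))
        ≡⟨ rearrange scale n a b ⟩
      n ℕ.* (4 ℕ.* scale ℕ.* a ℕ.+ 4 ℕ.* scale ℕ.* b)
        ≤⟨ ℕ.*-monoʳ-≤ n (ℕ.+-mono-≤ (small endS) (small startT)) ⟩
      n ℕ.* (2 ℕ.* n ℕ.+ 2 ℕ.* n)
        ≡⟨ four-squares n ⟩
      4 ℕ.* (n ℕ.* n) ∎)
      where
      open ℕ.≤-Reasoning
      rearrange : ∀ K n a b → 4 ℕ.* (K ℕ.* (n ℕ.* (a ℕ.+ b))) ≡ n ℕ.* (4 ℕ.* K ℕ.* a ℕ.+ 4 ℕ.* K ℕ.* b)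
      rearrange = solve-∀
      four-squares : ∀ n → n ℕ.* (2 ℕ.* n ℕ.+ 2 ℕ.* n) ≡ 4 ℕ.* (n ℕ.* n)
      four-squares = solve-∀
    open ℚ.≤-Reasoning
    N³ κ N² H E : ℚᵘ
    N³ = ℕ→ℚ (N ℕ.* (N ℕ.* N))
    κ = ℕ→ℚ scale
    N² = ℕ→ℚ (n ℕ.* n)
    H = Σ² n (λ u v → abs (change G P refinement refinement-refines u v))
    E = Σ² n (λ u v → ℕ→ℚ (error u v))
    κ≃2N³ : κ ≃ ℕ→ℚ 2 * N³
    κ≃2N³ = ℕ→ℚ-* 2 (N ℕ.* (N ℕ.* N))
    κE≤n² : κ * E ≤ N²
    κE≤n² = begin
      κ * E
        ≃⟨ ℚ.*-congˡ {κ} (ℚ.≃-trans (ℚ.≃-sym (ℕ→ℚ-Σ² n error)) (ℚ.≃-reflexive (cong ℕ→ℚ total-error))) ⟩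
      κ * ℕ→ℚ (n ℕ.* (a ℕ.+ b))
        ≃⟨ ℕ→ℚ-* scale (n ℕ.* (a ℕ.+ b)) ⟨
      ℕ→ℚ (scale ℕ.* (n ℕ.* (a ℕ.+ b)))
        ≤⟨ ℕ→ℚ-mono scaled-error ⟩
      N² ∎
    n²≤N³[H+E] : N² ≤ N³ * (H + E)
    n²≤N³[H+E] = ℚ.≤-trans (violation-bound N G P S T violation)
      (ℚ.*-monoʳ-≤-nonNeg N³ (irregularity≤change G P refinement refinement-refines S T σ τ
        (λ u v → ℕ→ℚ (error u v)) error-bound))
    -- Doubling turns N³ into `κ` and n² into 2n²; the error term accounts for at most one n², and
    -- the change for the rest.
    n²≤KH : N² ≤ κ * H
    n²≤KH = begin
      N²
        ≃⟨ solve 1 (λ n → n := n :+ n :- n) ℚ.≃-refl N² ⟩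
      N² + N² - N²
        ≤⟨ ℚ.+-monoˡ-≤ (- N²) (ℚ.+-mono-≤ n²≤N³[H+E] n²≤N³[H+E]) ⟩
      N³ * (H + E) + N³ * (H + E) - N²
        ≃⟨ solve 4 (λ n H E m → n :* (H :+ E) :+ n :* (H :+ E) :- m :=
             con (ℕ→ℚ 2) :* n :* H :+ con (ℕ→ℚ 2) :* n :* E :- m) ℚ.≃-refl N³ H E N² ⟩
      ℕ→ℚ 2 * N³ * H + ℕ→ℚ 2 * N³ * E - N²
        ≃⟨ ℚ.+-congˡ (- N²) (ℚ.+-cong (ℚ.*-congʳ {H} κ≃2N³) (ℚ.*-congʳ {E} κ≃2N³)) ⟨
      κ * H + κ * E - N²
        ≤⟨ ℚ.+-monoˡ-≤ (- N²) (ℚ.+-monoʳ-≤ (κ * H) κE≤n²) ⟩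
      κ * H + N² - N²
        ≃⟨ solve 2 (λ x n → x :+ n :- n := x) ℚ.≃-refl (κ * H) N² ⟩
      κ * H ∎

  RegularRefinement : ∀ {n k} → Graph n → Partition n k → ℕ → Set
  RegularRefinement {n} G P bound = Σ ℕ λ k′ → Σ (Partition n k′) λ P′ →
    IsEquipartition P′ × Refines P′ P × Regular N G P′ × k′ ℕ.≤ bound

  -- If n is at most `k * branching`, the singletons are few enough; otherwise all cells are large
  -- enough to be cut. `0 < n` is recorded because a gain proportional to n² is progress only then.
  improve : ∀ {n k} (G : Graph n) (P : Partition n k) → IsEquipartition P →
    RegularRefinement G P (k ℕ.* branching) ⊎ (0 ℕ.< n × Increment G P)
  improve {n} {k} G P equi = by-size (n ℕ.≤? k ℕ.* branching)
    where
    by-violation : ¬ n ℕ.≤ k ℕ.* branching → Dec (Σ (Subset n) λ S → Σ (Subset n) λ T → Violation N G P S T) →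
      RegularRefinement G P (k ℕ.* branching) ⊎ (0 ℕ.< n × Increment G P)
    by-violation n≰kt (no none) = inj₁ (k , P , equi , (id , λ _ → refl) ,
      (λ S T v → none (S , T , v)) , ℕ.m≤m*n k branching)
    by-violation n≰kt (yes (S , T , v)) = inj₂ (ℕ.≤-<-trans ℕ.z≤n (ℕ.≰⇒> n≰kt) ,
      violation⇒increment G P equi (large-cells branching-1 P equi n≰kt) S T v)
    by-size : Dec (n ℕ.≤ k ℕ.* branching) → RegularRefinement G P (k ℕ.* branching) ⊎ (0 ℕ.< n × Increment G P)
    by-size (yes n≤kt) = inj₁ (n , singletons n , singletons-equi n , (part P , λ _ → refl) ,
      singletons-regular n N G , n≤kt)
    by-size (no n≰kt) = by-violation n≰kt (anySubset? (λ S → anySubset? (λ T → violation? N G P S T)))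

  weaken : ∀ {n k} (G : Graph n) (P : Partition n k) {b b′} → b ℕ.≤ b′ →
    RegularRefinement G P b → RegularRefinement G P b′
  weaken G P b≤b′ (k′ , P′ , equi′ , refines , regular , k′≤b) =
    k′ , P′ , equi′ , refines , regular , ℕ.≤-trans k′≤b b≤b′

  compose : ∀ {n k k′} (G : Graph n) (P : Partition n k) (P′ : Partition n k′) {b} →
    Refines P′ P → RegularRefinement G P′ b → RegularRefinement G P b
  compose G P P′ (f , r) (k″ , P″ , equi″ , (f′ , r′) , rest) =
    k″ , P″ , equi″ , (f ∘ f′ , λ v → ≡.trans (r v) (cong f (r′ v))) , rest

  -- The hypothesis makes fuel run out only when the energy would exceed its maximum n².
  search : ∀ {n k} fuel (G : Graph n) (P : Partition n k) → IsEquipartition P →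
    (0 ℕ.< n → ℕ→ℚ (scale ℕ.* scale) * ℕ→ℚ (n ℕ.* n) <
      ℕ→ℚ (scale ℕ.* scale) * energy G P + ℕ→ℚ (fuel ℕ.* (n ℕ.* n))) →
    RegularRefinement G P (k ℕ.* branching ℕ.^ suc fuel)
  search {n} {k} fuel G P equi enough = [ weaken G P kt≤ , continue fuel enough ]′ (improve G P equi)
    where
    -- The exponent exceeds the fuel by one to make room for the singletons, which can cost a factor
    -- `branching` even after the fuel is spent.
    kt≤ : k ℕ.* branching ℕ.≤ k ℕ.* branching ℕ.^ suc fuel
    kt≤ = ℕ.*-monoʳ-≤ k (ℕ.m≤m*n branching (branching ℕ.^ fuel) {{ℕ.m^n≢0 branching fuel}})
    continue : ∀ fuel → (0 ℕ.< n → ℕ→ℚ (scale ℕ.* scale) * ℕ→ℚ (n ℕ.* n) <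
        ℕ→ℚ (scale ℕ.* scale) * energy G P + ℕ→ℚ (fuel ℕ.* (n ℕ.* n))) →
      0 ℕ.< n × Increment G P → RegularRefinement G P (k ℕ.* branching ℕ.^ suc fuel)
    continue zero enough (0<n , _) = contradiction
      (ℚ.≤-trans (ℚ.≤-reflexive (ℚ.+-identityʳ _))
        (ℚ.*-monoʳ-≤-nonNeg (ℕ→ℚ (scale ℕ.* scale)) (energy≤n² G P)))
      (ℚ.<⇒≱ (enough 0<n))
    continue (suc fuel) enough (_ , P′ , equi′ , r , increment) =
      weaken G P (ℕ.≤-reflexive (ℕ.*-assoc k branching (branching ℕ.^ suc fuel)))
        (compose G P P′ r (search fuel G P′ equi′ (λ 0<n → ℚ.<-≤-trans (enough 0<n) (more (ℕ→ℚ (scale ℕ.* scale) * energy G P) _ increment))))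
      where
      open ℚ.≤-Reasoning
      more : ∀ x y → x + ℕ→ℚ (n ℕ.* n) ≤ y →
        x + ℕ→ℚ (suc fuel ℕ.* (n ℕ.* n)) ≤ y + ℕ→ℚ (fuel ℕ.* (n ℕ.* n))
      more x y h = begin
        x + ℕ→ℚ (n ℕ.* n ℕ.+ fuel ℕ.* (n ℕ.* n))
          ≃⟨ ℚ.+-congʳ x (ℕ→ℚ-+ (n ℕ.* n) (fuel ℕ.* (n ℕ.* n))) ⟩
        x + (ℕ→ℚ (n ℕ.* n) + ℕ→ℚ (fuel ℕ.* (n ℕ.* n)))
          ≃⟨ ℚ.+-assoc x (ℕ→ℚ (n ℕ.* n)) (ℕ→ℚ (fuel ℕ.* (n ℕ.* n))) ⟨
        x + ℕ→ℚ (n ℕ.* n) + ℕ→ℚ (fuel ℕ.* (n ℕ.* n))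
          ≤⟨ ℚ.+-monoˡ-≤ (ℕ→ℚ (fuel ℕ.* (n ℕ.* n))) h ⟩
        y + ℕ→ℚ (fuel ℕ.* (n ℕ.* n)) ∎

  regular-refinement : ∀ {n k} (G : Graph n) (P : Partition n k) → IsEquipartition P →
    RegularRefinement G P (k ℕ.* branching ℕ.^ suc steps)
  regular-refinement {n} G P equi = search steps G P equi λ 0<n → begin-strict
    ℕ→ℚ (scale ℕ.* scale) * ℕ→ℚ (n ℕ.* n)
      ≃⟨ ℕ→ℚ-* (scale ℕ.* scale) (n ℕ.* n) ⟨
    ℕ→ℚ (scale ℕ.* scale ℕ.* (n ℕ.* n))
      <⟨ ℕ→ℚ-mono-< (ℕ.m<n+m _ (ℕ.*-mono-< 0<n 0<n)) ⟩
    ℕ→ℚ (steps ℕ.* (n ℕ.* n))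
      ≃⟨ ℚ.+-identityˡ _ ⟨
    0ℚᵘ + ℕ→ℚ (steps ℕ.* (n ℕ.* n))
      ≤⟨ ℚ.+-monoˡ-≤ (ℕ→ℚ (steps ℕ.* (n ℕ.* n))) (ℚ.≤-trans
           (ℚ.≤-reflexive (ℚ.≃-sym (ℚ.*-zeroʳ (ℕ→ℚ (scale ℕ.* scale)))))
           (ℚ.*-monoʳ-≤-nonNeg (ℕ→ℚ (scale ℕ.* scale)) (0≤energy G P))) ⟩
    ℕ→ℚ (scale ℕ.* scale) * energy G P + ℕ→ℚ (steps ℕ.* (n ℕ.* n)) ∎
    where
    open ℚ.≤-Reasoning
    ℕ→ℚ-mono-< : ∀ {a b} → a ℕ.< b → ℕ→ℚ a < ℕ→ℚ b
    ℕ→ℚ-mono-< a<b = ℚ.*<* (ℤ.*-monoʳ-<-pos (+ 1) (ℤ.+<+ a<b))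

-- The polynomial in the exponent

1+X*+ : ℕ → List ℕ → List ℕ
1+X*+ c []       = c ∷ []
-- The coefficient `d` counts in its own place and is carried to the next one, for the product with
-- X.
1+X*+ c (d ∷ ds) = c ℕ.+ d ∷ 1+X*+ d ds

evalPoly-1+X*+ : ∀ c cs x → evalPoly (1+X*+ c cs) x ≃ ℕ→ℚ c + (1ℚᵘ + x) * evalPoly cs x
evalPoly-1+X*+ c [] x =
  solve 2 (λ c x → c :+ x :* con 0ℚᵘ := c :+ (con 1ℚᵘ :+ x) :* con 0ℚᵘ) ℚ.≃-refl (ℕ→ℚ c) x
evalPoly-1+X*+ c (d ∷ ds) x = begin-equality
  ℕ→ℚ (c ℕ.+ d) + x * evalPoly (1+X*+ d ds) x
    ≃⟨ ℚ.+-cong (ℕ→ℚ-+ c d) (ℚ.*-congˡ {x} (evalPoly-1+X*+ d ds x)) ⟩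
  ℕ→ℚ c + ℕ→ℚ d + x * (ℕ→ℚ d + (1ℚᵘ + x) * evalPoly ds x)
    ≃⟨ solve 4 (λ c d x y → c :+ d :+ x :* (d :+ (con 1ℚᵘ :+ x) :* y) :=
         c :+ (con 1ℚᵘ :+ x) :* (d :+ x :* y)) ℚ.≃-refl (ℕ→ℚ c) (ℕ→ℚ d) x (evalPoly ds x) ⟩
  ℕ→ℚ c + (1ℚᵘ + x) * (ℕ→ℚ d + x * evalPoly ds x) ∎
  where open ℚ.≤-Reasoning

-- Coefficients of `c (1 + X)^j`; the shift by 1 absorbs the rounding of 1/ε to an integer.
shifted-power : ℕ → ℕ → List ℕ
shifted-power c zero    = c ∷ []
shifted-power c (suc j) = 1+X*+ 0 (shifted-power c j)

≤-shifted-power : ∀ c j N x → ℕ→ℚ N ≤ 1ℚᵘ + x →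
  ℕ→ℚ (N ℕ.^ j ℕ.* c) ≤ evalPoly (shifted-power c j) x
≤-shifted-power c zero    N x N≤1+x = begin
  ℕ→ℚ (1 ℕ.* c)      ≡⟨ cong ℕ→ℚ (ℕ.*-identityˡ c) ⟩
  ℕ→ℚ c              ≃⟨ solve 2 (λ c x → c := c :+ x :* con 0ℚᵘ) ℚ.≃-refl (ℕ→ℚ c) x ⟩
  ℕ→ℚ c + x * 0ℚᵘ    ∎
  where open ℚ.≤-Reasoning
≤-shifted-power c (suc j) N x N≤1+x = begin
  ℕ→ℚ (N ℕ.* N ℕ.^ j ℕ.* c)
    ≡⟨ cong ℕ→ℚ (ℕ.*-assoc N (N ℕ.^ j) c) ⟩
  ℕ→ℚ (N ℕ.* (N ℕ.^ j ℕ.* c))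
    ≃⟨ ℕ→ℚ-* N (N ℕ.^ j ℕ.* c) ⟩
  ℕ→ℚ N * ℕ→ℚ (N ℕ.^ j ℕ.* c)
    ≤⟨ ℚ.*-mono-≤-nonNeg N≤1+x (≤-shifted-power c j N x N≤1+x) ⟩
  (1ℚᵘ + x) * evalPoly (shifted-power c j) x
    ≃⟨ ℚ.+-identityˡ _ ⟨
  0ℚᵘ + (1ℚᵘ + x) * evalPoly (shifted-power c j) x
    ≃⟨ evalPoly-1+X*+ 0 (shifted-power c j) x ⟨
  evalPoly (1+X*+ 0 (shifted-power c j)) x ∎
  where open ℚ.≤-Reasoning

n≤2^n : ∀ n → n ℕ.≤ 2 ℕ.^ n
n≤2^n zero    = ℕ.z≤n
n≤2^n (suc n) = begin
  1 ℕ.+ n              ≤⟨ ℕ.+-mono-≤ (ℕ.m^n>0 2 n) (n≤2^n n) ⟩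
  2 ℕ.^ n ℕ.+ 2 ℕ.^ n  ≡⟨ cong (2 ℕ.^ n ℕ.+_) (ℕ.+-identityʳ _) ⟨
  2 ℕ.* 2 ℕ.^ n        ∎
  where open ℕ.≤-Reasoning

*-^ : ∀ m n o → (m ℕ.* n) ℕ.^ o ≡ m ℕ.^ o ℕ.* n ℕ.^ o
*-^ m n zero    = refl
*-^ m n (suc o) = ≡.trans (cong (m ℕ.* n ℕ.*_) (*-^ m n o))
  (ℕ.[m*n]*[o*p]≡[m*o]*[n*p] m n (m ℕ.^ o) (n ℕ.^ o))

-- For `r = a/(b+1)` the bound `M ≤ r` says `M (b+1) ≤ a`, so it suffices to raise `k ≤ k₀ 2^M` to
-- the power `b+1`.
boundedBy : ∀ k k₀ M r → k ℕ.≤ k₀ ℕ.* 2 ℕ.^ M → ℕ→ℚ M ≤ r → BoundedBy k k₀ r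
boundedBy k k₀ M r k≤ M≤r a b r≃a/b = begin
  k ℕ.^ suc b
    ≤⟨ ℕ.^-monoˡ-≤ (suc b) k≤ ⟩
  (k₀ ℕ.* 2 ℕ.^ M) ℕ.^ suc b
    ≡⟨ *-^ k₀ (2 ℕ.^ M) (suc b) ⟩
  k₀ ℕ.^ suc b ℕ.* (2 ℕ.^ M) ℕ.^ suc b
    ≡⟨ cong (k₀ ℕ.^ suc b ℕ.*_) (ℕ.^-*-assoc 2 M (suc b)) ⟩
  k₀ ℕ.^ suc b ℕ.* 2 ℕ.^ (M ℕ.* suc b)
    ≤⟨ ℕ.*-monoʳ-≤ (k₀ ℕ.^ suc b) (ℕ.^-monoʳ-≤ 2 M[1+b]≤a) ⟩
  k₀ ℕ.^ suc b ℕ.* 2 ℕ.^ a ∎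
  where
  open ℕ.≤-Reasoning
  M[1+b]≤a : M ℕ.* suc b ℕ.≤ a
  M[1+b]≤a = ℤ.drop‿+≤+ (≡.subst₂ ℤ._≤_ (≡.sym (ℤ.pos-* M (suc b))) (ℤ.*-identityʳ (+ a))
    (ℚ.drop-*≤* (ℚ.≤-respʳ-≃ r≃a/b M≤r)))

-- The product is `(8N³ + 1)(4N⁶ + 2)`; as `N ≥ 1`, every power of N is raised to N⁹, and the
-- coefficients 2, 16, 4 and 32 add up to 54.
exponent-bound : ∀ N .{{_ : ℕ.NonZero N}} → branching N ℕ.* suc (steps N) ℕ.≤ N ℕ.^ 9 ℕ.* 54
exponent-bound N = begin
  branching N ℕ.* suc (steps N)
    ≡⟨ expand N³ ⟩
  2 ℕ.+ (16 ℕ.* N³ ℕ.+ 4 ℕ.* (N³ ℕ.* N³) ℕ.+ 32 ℕ.* N⁹)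
    ≤⟨ ℕ.+-mono-≤ (ℕ.*-monoʳ-≤ 2 (ℕ.≤-trans 1≤N³ N³≤N⁹))
         (ℕ.+-monoˡ-≤ (32 ℕ.* N⁹) (ℕ.+-mono-≤ (ℕ.*-monoʳ-≤ 16 N³≤N⁹) (ℕ.*-monoʳ-≤ 4 N⁶≤N⁹))) ⟩
  2 ℕ.* N⁹ ℕ.+ (16 ℕ.* N⁹ ℕ.+ 4 ℕ.* N⁹ ℕ.+ 32 ℕ.* N⁹)
    ≡⟨ collect N⁹ ⟩
  N⁹ ℕ.* 54
    ≡⟨ cong (ℕ._* 54) (≡.trans (cong (λ c → c ℕ.* (c ℕ.* c)) (≡.sym N^3≡N³)) (≡.trans
         (≡.sym (cong (N ℕ.^ 3 ℕ.*_) (ℕ.^-distribˡ-+-* N 3 3))) (≡.sym (ℕ.^-distribˡ-+-* N 3 6)))) ⟩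
  N ℕ.^ 9 ℕ.* 54 ∎
  where
  open ℕ.≤-Reasoning
  N³ = N ℕ.* (N ℕ.* N)
  N⁹ = N³ ℕ.* (N³ ℕ.* N³)
  N^3≡N³ : N ℕ.^ 3 ≡ N³
  N^3≡N³ = cong (λ x → N ℕ.* (N ℕ.* x)) (ℕ.*-identityʳ N)
  1≤N³ : 1 ℕ.≤ N³
  1≤N³ = ≡.subst (1 ℕ.≤_) N^3≡N³ (ℕ.m^n>0 N 3)
  N⁶≤N⁹ : N³ ℕ.* N³ ℕ.≤ N⁹
  N⁶≤N⁹ = ℕ.m≤n*m (N³ ℕ.* N³) N³ {{ℕ.>-nonZero 1≤N³}}
  N³≤N⁹ : N³ ℕ.≤ N⁹
  N³≤N⁹ = ℕ.≤-trans (ℕ.m≤m*n N³ N³ {{ℕ.>-nonZero 1≤N³}}) N⁶≤N⁹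
  expand : ∀ c → suc (4 ℕ.* (2 ℕ.* c)) ℕ.* suc (suc (2 ℕ.* c ℕ.* (2 ℕ.* c))) ≡
    2 ℕ.+ (16 ℕ.* c ℕ.+ 4 ℕ.* (c ℕ.* c) ℕ.+ 32 ℕ.* (c ℕ.* (c ℕ.* c)))
  expand = solve-∀
  collect : ∀ d → 2 ℕ.* d ℕ.+ (16 ℕ.* d ℕ.+ 4 ℕ.* d ℕ.+ 32 ℕ.* d) ≡ d ℕ.* 54
  collect = solve-∀

-- The choice `N = 1 + ⌊1/ε⌋` satisfies both bounds at once.
reciprocal-ceiling : ∀ ε (ε>0 : ε > 0ℚᵘ) → Σ ℕ λ N → ℕ.NonZero N ×
  1ℚᵘ ≤ ℕ→ℚ N * ε × ℕ→ℚ N ≤ 1ℚᵘ + inv ε ε>0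
reciprocal-ceiling (mkℚᵘ (+ 0) b)    (ℚ.*<* (ℤ.+<+ ()))
reciprocal-ceiling (mkℚᵘ -[1+ a ] b) (ℚ.*<* ())
reciprocal-ceiling ε@(mkℚᵘ +[1+ a ] b) ε>0 = suc m , _ ,
  ℚ.≤-trans (ℚ.≤-reflexive (ℚ.≃-sym (ℚ.*-inverseˡ ε))) (ℚ.*-monoˡ-≤-nonNeg ε 1/ε≤1+m) ,
  ℚ.≤-trans (ℚ.≤-reflexive (ℕ→ℚ-+ 1 m)) (ℚ.+-monoʳ-≤ 1ℚᵘ m≤1/ε)
  where
  m = suc b ℕ./ suc a
  m≤1/ε : ℕ→ℚ m ≤ inv ε ε>0
  m≤1/ε = ℚ.*≤* (≡.subst₂ ℤ._≤_ (ℤ.pos-* m (suc a)) (≡.sym (ℤ.*-identityʳ (+ suc b)))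
    (ℤ.+≤+ (ℕ.m/n*n≤m (suc b) (suc a))))
  1/ε≤1+m : inv ε ε>0 ≤ ℕ→ℚ (suc m)
  1/ε≤1+m = ℚ.*≤* (≡.subst₂ ℤ._≤_ (≡.sym (ℤ.*-identityʳ (+ suc b))) (ℤ.pos-* (suc m) (suc a))
    (ℤ.+≤+ (ℕ.≤-trans (ℕ.≤-reflexive (ℕ.m≡m%n+[m/n]*n (suc b) (suc a)))
      (ℕ.+-monoˡ-≤ (m ℕ.* suc a) (ℕ.<⇒≤ (ℕ.m%n<n (suc b) (suc a)))))))

weakRegular-refinement : ∀ N .{{_ : ℕ.NonZero N}} ε x → 1ℚᵘ ≤ ℕ→ℚ N * ε → ℕ→ℚ N ≤ 1ℚᵘ + x →
  ∀ {n k₀} (G : Graph n) (P₀ : Partition n k₀) → IsEquipartition P₀ →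
  Σ ℕ λ k → Σ (Partition n k) λ P → IsEquipartition P × Refines P P₀ × WeakRegular G ε P ×
    BoundedBy k k₀ (evalPoly (shifted-power 54 9) x)
weakRegular-refinement N ε x 1≤Nε N≤1+x {n} {k₀} G P₀ equi =
  finish (regular-refinement N G P₀ equi)
  where
  t = branching N
  s = suc (steps N)
  -- The crude `t ≤ 2^t` in place of a logarithm still leaves the exponent `t * s` polynomial in N.
  t^s≤2^ts : t ℕ.^ s ℕ.≤ 2 ℕ.^ (t ℕ.* s)
  t^s≤2^ts = ℕ.≤-trans (ℕ.^-monoˡ-≤ s (n≤2^n t)) (ℕ.≤-reflexive (ℕ.^-*-assoc 2 t s))
  finish : RegularRefinement N G P₀ (k₀ ℕ.* t ℕ.^ s) → Σ ℕ λ k → Σ (Partition n k) λ P →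
    IsEquipartition P × Refines P P₀ × WeakRegular G ε P ×
    BoundedBy k k₀ (evalPoly (shifted-power 54 9) x)
  finish (k , P , equi′ , refines , regular , k≤) =
    k , P , equi′ , refines , regular⇒weakRegular N G P 1≤Nε regular ,
    boundedBy k k₀ (t ℕ.* s) (evalPoly (shifted-power 54 9) x)
      (ℕ.≤-trans k≤ (ℕ.*-monoʳ-≤ k₀ t^s≤2^ts))
      (ℚ.≤-trans (ℕ→ℚ-mono (exponent-bound N)) (≤-shifted-power 54 9 N x N≤1+x))

theorem2p2 : Σ (List ℕ) (λ q →
    ∀ (ε : ℚᵘ) (ε>0 : ε > 0ℚᵘ) (n : ℕ) (G : Graph n)
    (k₀ : ℕ) (P₀ : Partition n k₀) → IsEquipartition P₀ →
    Σ ℕ (λ k → Σ (Partition n k) (λ P →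
    IsEquipartition P × Refines P P₀ × WeakRegular G ε P
    × BoundedBy k k₀ (evalPoly q (inv ε ε>0)))))
theorem2p2 = shifted-power 54 9 , λ ε ε>0 n G k₀ P₀ equi →
  let N , N≢0 , 1≤Nε , N≤1+1/ε = reciprocal-ceiling ε ε>0
  in weakRegular-refinement N {{N≢0}} ε (inv ε ε>0) 1≤Nε N≤1+1/ε G P₀ equi
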